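{- If $F$ is a random continuous function, then $\lambda(\mathrm{ran}(F))>0$.
   Context: $\lambda$ is the uniform (Lebesgue) measure on $2^\omega$. Martin-Löf randomness of $x\in3^\omega$ is with respect to the uniform measure $\lambda_3$: $x$ is Martin-Löf random if $x\notin\bigcap_iU_i$ for every uniformly $\Sigma^0_1$ sequence $(U_i)$ of open subsets of $3^\omega$ with $\lambda_3(U_i)\le2^{ -i}$. Let $\sigma_0=\epsilon,\sigma_1=0,\sigma_2=1,\dots$ be the length-lexicographic enumeration of $2^{<\omega}$. For $x\in3^\omega$ label node $\sigma_i$ ($i\ge1$) by $\ell_x(\sigma_i)=x(i-1)$, and let $F_x(y)$ be the sequence obtained from $\ell_x(y\restriction1),\ell_x(y\restriction2),\dots$ by deleting all $2$'s (undefined if only finitely many entries remain). $F$ is a random continuous function if $F=F_x$ for some Martin-Löf random $x\in3^\omega$. $\mathrm{ran}(F)$ denotes the range of $F$. -}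

module Defs where

open import Level using (0ℓ)
open import Data.Fin.Base using (Fin; zero; suc; toℕ)
open import Data.Integer.Base using (+_)
open import Data.List.Base
  using (List; []; _∷_; length; foldl; foldr; reverse; mapMaybe; applyUpTo)
open import Data.List.Properties using (reverse-foldr; reverse-involutive)
open import Data.Maybe.Base using (Maybe; just; nothing)
open import Data.Nat.Base as ℕ using (ℕ; zero; suc; pred; NonZero)
open import Data.Nat.Properties using (+-suc; +-identityʳ)
open import Data.Product.Base using (∃; ∃₂; _×_)
open import Data.Rational.Base
  using (ℚ; 0ℚ; ½; _+_; _≤_; _<_; _/_; +-*-rawSemiring)
open import Data.Vec.Base using (Vec; []; _∷_; lookup)
open import Data.Vec.Relation.Binary.Pointwise.Inductive using (Pointwise)
open import Algebra.Definitions.RawSemiring +-*-rawSemiring using (_^_)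
open import Function.Bundles using (_⇔_)
open import Relation.Binary.Core using (REL)
open import Relation.Binary.PropositionalEquality
  using (_≡_; refl; sym; trans; cong; module ≡-Reasoning)
open import Relation.Nullary.Negation.Core using (¬_)
open import Relation.Unary using (Pred; _∈_; _⊆_)

------------------------------------------------------------------------
-- Strings and infinite sequences over the alphabet {0,…,k-1}

Str : ℕ → Set
Str k = List (Fin k)

Seq : ℕ → Set
Seq k = ℕ → Fin k

infix 10 _↾_
_↾_ : ∀ {k} → Seq k → ℕ → Str k
x ↾ n = applyUpTo x n

cylinder : ∀ {k} → Str k → Pred (Seq k) 0ℓ
cylinder σ x = x ↾ length σ ≡ σ

-- The position of σ in the length-lexicographic enumeration of all strings
-- over k letters (bijective base-k numeration, the empty string at 0).

index : ∀ {k} → Str k → ℕ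
index {k} = foldl (λ i a → suc (k ℕ.* i ℕ.+ toℕ a)) 0

------------------------------------------------------------------------
-- Uniform measure

-- A countable family of cylinders; `nothing` stands for the empty set, so
-- that finite and empty families are included.

Family : ℕ → Set
Family k = ℕ → Maybe (Str k)

⋃ : ∀ {k} → Family k → Pred (Seq k) 0ℓ
⋃ c x = ∃₂ λ n σ → c n ≡ just σ × x ∈ cylinder σ

module _ {k : ℕ} .{{_ : NonZero k}} where

  weight : Maybe (Str k) → ℚ
  weight nothing  = 0ℚ
  weight (just σ) = (+ 1 / k) ^ length σ

  partialSum : Family k → ℕ → ℚ
  partialSum c n = foldr (λ m s → weight m + s) 0ℚ (applyUpTo c n)

  -- The uniform measure of a measurable set A is its outer measure, i.e. the
  -- infimum, over all families of cylinders covering A, of the total weight.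
  -- As there are no real numbers here, only comparisons of this infimum with
  -- rationals are defined; a total weight is the supremum of its partial sums.

  Measure≤ : Pred (Seq k) 0ℓ → ℚ → Set
  Measure≤ A q = ∀ ε → 0ℚ < ε →
    ∃ λ c → A ⊆ ⋃ c × (∀ n → partialSum c n ≤ q + ε)

  Measure> : Pred (Seq k) 0ℓ → ℚ → Set
  Measure> A q = ∃ λ r → q < r ×
    (∀ c → A ⊆ ⋃ c → ∃ λ n → r ≤ partialSum c n)

------------------------------------------------------------------------
-- Partial recursive functions

data Code : ℕ → Set where
  zeroᶜ : ∀ {n} → Code n
  sucᶜ  : Code 1
  proj  : ∀ {n} → Fin n → Code n
  comp  : ∀ {m n} → Code m → Vec (Code n) m → Code n
  prec  : ∀ {n} → Code n → Code (suc (suc n)) → Code (suc n)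
  min   : ∀ {n} → Code (suc n) → Code n

infix 4 _[_]⇓_
data _[_]⇓_ : ∀ {n} → Code n → Vec ℕ n → ℕ → Set where
  ⇓zero  : ∀ {n} {xs : Vec ℕ n} → zeroᶜ [ xs ]⇓ 0
  ⇓suc   : ∀ {x} → sucᶜ [ x ∷ [] ]⇓ suc x
  ⇓proj  : ∀ {n} {xs : Vec ℕ n} {i} → proj i [ xs ]⇓ lookup xs i
  ⇓comp  : ∀ {m n} {f : Code m} {gs : Vec (Code n) m} {xs ys z} →
           Pointwise (λ g y → g [ xs ]⇓ y) gs ys → f [ ys ]⇓ z →
           comp f gs [ xs ]⇓ z
  ⇓prec0 : ∀ {n} {f : Code n} {g xs y} →
           f [ xs ]⇓ y → prec f g [ 0 ∷ xs ]⇓ y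
  ⇓precS : ∀ {n} {f : Code n} {g xs m y z} →
           prec f g [ m ∷ xs ]⇓ y → g [ m ∷ y ∷ xs ]⇓ z →
           prec f g [ suc m ∷ xs ]⇓ z
  ⇓min   : ∀ {n} {f : Code (suc n)} {xs y} →
           f [ y ∷ xs ]⇓ 0 →
           (∀ j → j ℕ.< y → ∃ λ v → f [ j ∷ xs ]⇓ suc v) →
           min f [ xs ]⇓ y

------------------------------------------------------------------------
-- Martin-Löf randomness

-- The uniformly Σ⁰₁ sequence of open sets given by e: the i-th set is the
-- union of the cylinders of those σ for which e halts on (i , index σ).

Σ₁Open : ∀ {k} → Code 2 → ℕ → Pred (Seq k) 0ℓ
Σ₁Open e i x =
  ∃₂ λ σ v → e [ i ∷ index σ ∷ [] ]⇓ v × x ∈ cylinder σ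

MLRandom : ∀ {k} .{{_ : NonZero k}} → Pred (Seq k) 0ℓ
MLRandom {k} x = (e : Code 2) →
  (∀ i → Measure≤ {k} (Σ₁Open e i) (½ ^ i)) →
  ¬ (∀ i → x ∈ Σ₁Open e i)

------------------------------------------------------------------------
-- Random continuous functions

-- Partial functions on Cantor space, as graphs.

PartialMap : Set₁
PartialMap = REL (Seq 2) (Seq 2) 0ℓ

ran : PartialMap → Pred (Seq 2) 0ℓ
ran F z = ∃ λ y → F y z

-- The label of the node σᵢ (i ≥ 1) is x (i - 1); see `label-enum` below.  The
-- value at the root is junk and never used.

label : Seq 3 → Str 2 → Fin 3
label x σ = x (pred (index σ))

bit? : Fin 3 → Maybe (Fin 2)
bit? zero             = just zero
bit? (suc zero)       = just (suc zero)
bit? (suc (suc zero)) = nothing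

-- Deleting all 2's from s leaves exactly the infinite sequence z: every initial
-- segment of z is what remains of some initial segment of s.  No such z
-- exists if only finitely many entries of s differ from 2.

Deletes2sTo : Seq 3 → Seq 2 → Set
Deletes2sTo s z = ∀ n → ∃ λ m → mapMaybe bit? (s ↾ m) ≡ z ↾ n

⟪_⟫ : Seq 3 → PartialMap
⟪ x ⟫ y z = Deletes2sTo (λ n → label x (y ↾ suc n)) z

RandomContinuous : PartialMap → Set
RandomContinuous F = ∃ λ x → MLRandom x × (∀ y z → F y z ⇔ ⟪ x ⟫ y z)

------------------------------------------------------------------------
-- `index` on binary strings inverts the length-lexicographic enumeration

-- Successor on reversed strings: increment with carry, where the successor of
-- 1…1 is the string of zeros that is one longer.

next : Str 2 → Str 2
next []             = zero ∷ []
next (zero     ∷ τ) = suc zero ∷ τ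
next (suc zero ∷ τ) = zero ∷ next τ

enumʳ : ℕ → Str 2
enumʳ zero    = []
enumʳ (suc i) = next (enumʳ i)

enum : ℕ → Str 2
enum i = reverse (enumʳ i)

private
  step : Fin 2 → ℕ → ℕ
  step a i = suc (2 ℕ.* i ℕ.+ toℕ a)

  indexʳ : Str 2 → ℕ
  indexʳ = foldr step 0

  indexʳ-next : ∀ τ → indexʳ (next τ) ≡ suc (indexʳ τ)
  indexʳ-next []             = refl
  indexʳ-next (zero     ∷ τ) = cong suc (+-suc (2 ℕ.* indexʳ τ) 0)
  indexʳ-next (suc zero ∷ τ) = begin
    suc (2 ℕ.* indexʳ (next τ) ℕ.+ 0)  ≡⟨ cong suc (+-identityʳ _) ⟩
    suc (2 ℕ.* indexʳ (next τ))        ≡⟨ cong (λ i → suc (2 ℕ.* i)) (indexʳ-next τ) ⟩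
    suc (suc (t ℕ.+ suc (t ℕ.+ 0)))    ≡⟨ cong (λ i → suc (suc i)) (+-suc t _) ⟩
    suc (suc (suc (2 ℕ.* t)))          ≡⟨ cong (λ i → suc (suc (suc i))) (+-identityʳ _) ⟨
    suc (suc (suc (2 ℕ.* t ℕ.+ 0)))    ≡⟨ cong (λ i → suc (suc i)) (+-suc (2 ℕ.* t) 0) ⟨
    suc (suc (2 ℕ.* t ℕ.+ 1))          ∎
    where
    open ≡-Reasoning
    t = indexʳ τ

  indexʳ-enumʳ : ∀ i → indexʳ (enumʳ i) ≡ i
  indexʳ-enumʳ zero    = refl
  indexʳ-enumʳ (suc i) =
    trans (indexʳ-next (enumʳ i)) (cong suc (indexʳ-enumʳ i))

  enumʳ-odd : ∀ n → enumʳ (suc (2 ℕ.* n)) ≡ zero ∷ enumʳ n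
  enumʳ-odd zero    = refl
  enumʳ-odd (suc n) rewrite +-suc n (n ℕ.+ 0) | enumʳ-odd n = refl

  enumʳ-indexʳ : ∀ τ → enumʳ (indexʳ τ) ≡ τ
  enumʳ-indexʳ []             = refl
  enumʳ-indexʳ (zero     ∷ τ)
    rewrite +-identityʳ (2 ℕ.* indexʳ τ) | enumʳ-odd (indexʳ τ) =
    cong (zero ∷_) (enumʳ-indexʳ τ)
  enumʳ-indexʳ (suc zero ∷ τ)
    rewrite +-suc (2 ℕ.* indexʳ τ) 0 | +-identityʳ (2 ℕ.* indexʳ τ)
          | enumʳ-odd (indexʳ τ) =
    cong (suc zero ∷_) (enumʳ-indexʳ τ)

  index≡indexʳ : ∀ σ → index σ ≡ indexʳ (reverse σ)
  index≡indexʳ σ = sym (reverse-foldr step 0 σ)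

index-enum : ∀ i → index (enum i) ≡ i
index-enum i = begin
  index (enum i)                       ≡⟨ index≡indexʳ (enum i) ⟩
  indexʳ (reverse (reverse (enumʳ i))) ≡⟨ cong indexʳ (reverse-involutive (enumʳ i)) ⟩
  indexʳ (enumʳ i)                     ≡⟨ indexʳ-enumʳ i ⟩
  i                                    ∎
  where open ≡-Reasoning

enum-index : ∀ σ → enum (index σ) ≡ σ
enum-index σ = begin
  enum (index σ)                        ≡⟨ cong enum (index≡indexʳ σ) ⟩
  reverse (enumʳ (indexʳ (reverse σ)))  ≡⟨ cong reverse (enumʳ-indexʳ (reverse σ)) ⟩
  reverse (reverse σ)                   ≡⟨ reverse-involutive σ ⟩
  σ                                     ∎
  where open ≡-Reasoning

label-enum : ∀ x i → label x (enum (suc i)) ≡ x i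
label-enum x i = cong (λ j → x (pred j)) (index-enum (suc i))

{-# OPTIONS --safe #-}

-- Fix N, give every node with number at most N the empty output, and call z
-- reached if some infinite path avoiding two consecutive labels 2 has output z.
-- For fixed z the nodes compatible with z form a supercritical branching process
-- whose N + 2 founders make the extinction probability at most (7/8)^(N+2).
-- Revealing the labels in the order of the nodes turns the product of the
-- individual extinction bounds into a supermartingale, still so after averaging
-- over z.  By the Kolmogorov inequality, with N = 4 + 6 i, the event "at some stage
-- at least half of all z are extinct" has measure at most 2^(-i), so these events
-- form a Martin-Löf test, and a random x escapes one of them.  For that N, a
-- cover of the range is by compactness a cover at a finite stage; each z not
-- extinct then is hit by it after prepending the output of one of the nodes up
-- to N, and as more than a fixed fraction of all z must be hit, the total weight
-- of the cover is bounded below.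

module Submission where

open import Defs
open import Level using (0ℓ)
open import Axiom.ExcludedMiddle using (ExcludedMiddle)
open import Data.Empty using (⊥; ⊥-elim)
open import Data.Fin.Base using (Fin; zero; suc; toℕ)
import Data.Fin.Properties as Fin
import Data.Integer.Base as ℤ
open import Data.List.Base
  using (List; []; _∷_; _++_; _∷ʳ_; length; map; foldr; foldl; replicate; applyUpTo; mapMaybe)
open import Data.List.Properties
  using (applyUpTo-∷ʳ; foldl-∷ʳ; ∷-injective; length-++; length-applyUpTo; mapMaybe-++; ++-assoc; ++-identityʳ; ∷ʳ-++)
open import Data.List.Relation.Unary.All using (All; []; _∷_)
import Data.List.Relation.Unary.All as All
import Data.List.Relation.Unary.All.Properties as All
open import Data.List.Relation.Unary.AllPairs using (AllPairs; []; _∷_)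
import Data.List.Relation.Unary.AllPairs as AllPairs
import Data.List.Relation.Unary.AllPairs.Properties as AllPairs
open import Data.List.Relation.Unary.Any using (Any; here; there)
open import Data.Maybe.Base using (Maybe; just; nothing)
open import Data.Nat.Base as ℕ using (ℕ; zero; suc; pred; s≤s; z≤n; z<s; s≤s⁻¹)
open import Data.Nat.DivMod using (m/n≤m; m*n/n≡m; /-monoˡ-≤; m<n*o⇒m/o<n)
import Data.Nat.Properties as ℕ
open import Data.Product.Base using (∃; _×_; _,_; proj₁; proj₂)
open import Data.Sum.Base using (_⊎_; inj₁; inj₂; [_,_]′)
open import Data.Vec.Base using ([]; _∷_)
open import Data.Vec.Relation.Binary.Pointwise.Inductive using ([]; _∷_)
open import Function.Bundles using (Equivalence)
open import Relation.Binary.PropositionalEquality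
open import Relation.Nullary.Decidable.Core using (Dec; yes; no)
open import Relation.Nullary.Negation.Core using (¬_; contradiction)
open import Relation.Unary using (_∈_; _⊆_)

-- Total computable functions and the test

-- For a fixed target a node emits the next bit with probability 1/3 and carries the label 2 with
-- probability 1/3. As 2 may not follow 2, the mean offspring matrix of the types `fresh` and
-- `paused` is 2/3 times the Fibonacci matrix. Its growth rate, 2/3 of the golden ratio, is about
-- 1.08: still supercritical, but barely, so the extinction bounds 7/8 and 59/64 lie close to 1. A
-- single founder dies out with positive probability, while a test needs measures 2^(-i). Ignoring
-- the first N labels buys many founders. The price is the output in front of a founder, which
-- shrinks the image of a set of targets by a factor 2^(-length). That factor is determined by x and
-- N before a cover is given, so one lower bound serves all covers, as `Measure>` demands. `Σ₁Open`
-- asks for a `Code`, so the test must be an arithmetical function of string numbers. Hence at stage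
-- L only targets of length L are considered, which is enough for all nodes numbered up to L. The
-- small cover of the test, the choice of i and compactness only require existence and are obtained
-- by excluded middle.

module Computability where

  open import Data.Fin.Properties using (toℕ<n)
  open import Data.Nat.Base
  open import Data.Nat.Divisibility using (n∣m*n)
  open import Data.Nat.DivMod
  open import Data.Nat.Induction using (<-rec)
  open import Data.Nat.Properties
  open import Data.Nat.Tactic.RingSolver using (solve-∀)
  open import Data.Vec.Base using (Vec; []; _∷_; lookup; tabulate)
  open import Data.Vec.Properties using (tabulate∘lookup)
  open import Data.Vec.Relation.Binary.Pointwise.Inductive using (Pointwise; []; _∷_)
  open import Function.Base using (_∘_)
  open import Relation.Binary.Definitions using (tri<; tri≈; tri>)

  mutual
    ⇓-deterministic : ∀ {n} {e : Code n} {xs y z} → e [ xs ]⇓ y → e [ xs ]⇓ z → y ≡ z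
    ⇓-deterministic ⇓zero ⇓zero = refl
    ⇓-deterministic ⇓suc ⇓suc = refl
    ⇓-deterministic ⇓proj ⇓proj = refl
    ⇓-deterministic (⇓comp p q) (⇓comp p′ q′)
      with refl ← ⇓*-deterministic p p′ = ⇓-deterministic q q′
    ⇓-deterministic (⇓prec0 p) (⇓prec0 p′) = ⇓-deterministic p p′
    ⇓-deterministic (⇓precS p q) (⇓precS p′ q′)
      with refl ← ⇓-deterministic p p′ = ⇓-deterministic q q′
    ⇓-deterministic (⇓min {y = y} p below) (⇓min {y = z} p′ below′) with <-cmp y z
    ... | tri< y<z _ _ with _ , r ← below′ y y<z = contradiction (⇓-deterministic p r) λ ()
    ... | tri≈ _ y≡z _ = y≡z
    ... | tri> _ _ z<y with _ , r ← below z z<y = contradiction (⇓-deterministic p′ r) λ ()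

    ⇓*-deterministic : ∀ {m n} {es : Vec (Code n) m} {xs ys zs} →
      Pointwise (λ e y → e [ xs ]⇓ y) es ys → Pointwise (λ e z → e [ xs ]⇓ z) es zs → ys ≡ zs
    ⇓*-deterministic [] [] = refl
    ⇓*-deterministic (p ∷ ps) (q ∷ qs) = cong₂ _∷_ (⇓-deterministic p q) (⇓*-deterministic ps qs)

  Computable : ∀ {n} → (Vec ℕ n → ℕ) → Set
  Computable {n} f = ∃ λ (e : Code n) → ∀ xs → e [ xs ]⇓ f xs

  private variable
    n : ℕ
    f g h k : Vec ℕ n → ℕ

  natrec : ℕ → (ℕ → ℕ → ℕ) → ℕ → ℕ
  natrec b s zero    = b
  natrec b s (suc m) = s m (natrec b s m)

  ext : (∀ xs → f xs ≡ g xs) → Computable f → Computable g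
  ext f≗g (e , p) = e , λ xs → subst (e [ xs ]⇓_) (f≗g xs) (p xs)

  var : (i : Fin n) → Computable (λ xs → lookup xs i)
  var i = proj i , λ _ → ⇓proj

  projections : ∀ {m} (ρ : Fin m → Fin n) (xs : Vec ℕ n) →
    Pointwise (λ e y → e [ xs ]⇓ y) (tabulate (proj ∘ ρ)) (tabulate (lookup xs ∘ ρ))
  projections {m = zero}  ρ xs = []
  projections {m = suc m} ρ xs = ⇓proj ∷ projections (ρ ∘ suc) xs

  skip₂ : Vec (Code (suc (suc n))) n
  skip₂ = tabulate (λ i → proj (suc (suc i)))

  skip₂-⇓ : ∀ m y (xs : Vec ℕ n) → Pointwise (λ e z → e [ m ∷ y ∷ xs ]⇓ z) skip₂ xs
  skip₂-⇓ m y xs =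
    subst (Pointwise _ _) (tabulate∘lookup xs) (projections (λ i → suc (suc i)) (m ∷ y ∷ xs))

  lift₁ : {h : Vec ℕ 1 → ℕ} → Computable h → Computable f → Computable (λ xs → h (f xs ∷ []))
  lift₁ (e , p) (e₁ , p₁) = comp e (e₁ ∷ []) , λ xs → ⇓comp (p₁ xs ∷ []) (p _)

  lift₂ : {h : Vec ℕ 2 → ℕ} → Computable h → Computable f → Computable g →
    Computable (λ xs → h (f xs ∷ g xs ∷ []))
  lift₂ (e , p) (e₁ , p₁) (e₂ , p₂) =
    comp e (e₁ ∷ e₂ ∷ []) , λ xs → ⇓comp (p₁ xs ∷ p₂ xs ∷ []) (p _)

  lift₄ : {h : Vec ℕ 4 → ℕ} {a b c d : Vec ℕ n → ℕ} → Computable h →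
    Computable a → Computable b → Computable c → Computable d →
    Computable (λ xs → h (a xs ∷ b xs ∷ c xs ∷ d xs ∷ []))
  lift₄ (e , p) (e₁ , p₁) (e₂ , p₂) (e₃ , p₃) (e₄ , p₄) =
    comp e (e₁ ∷ e₂ ∷ e₃ ∷ e₄ ∷ []) , λ xs → ⇓comp (p₁ xs ∷ p₂ xs ∷ p₃ xs ∷ p₄ xs ∷ []) (p _)

  recursion : {b k : Vec ℕ n → ℕ} {s : Vec ℕ (suc (suc n)) → ℕ} →
    Computable b → Computable s → Computable k →
    Computable (λ xs → natrec (b xs) (λ m y → s (m ∷ y ∷ xs)) (k xs))
  recursion {b = b} {k} {s} (e , p) (e′ , p′) (e″ , p″) =
    comp (prec e e′) (e″ ∷ tabulate proj) , λ xs →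
      ⇓comp (p″ xs ∷ subst (Pointwise _ _) (tabulate∘lookup xs) (projections (λ i → i) xs)) (iterate xs (k xs))
    where
    iterate : ∀ xs m → prec e e′ [ m ∷ xs ]⇓ natrec (b xs) (λ m y → s (m ∷ y ∷ xs)) m
    iterate xs zero    = ⇓prec0 (p xs)
    iterate xs (suc m) = ⇓precS (iterate xs m) (p′ _)

  sucᶜᵒ : Computable f → Computable (λ xs → suc (f xs))
  sucᶜᵒ = lift₁ {h = λ xs → suc (lookup xs zero)} (sucᶜ , λ { (x ∷ []) → ⇓suc })

  literal : ∀ c → Computable {n} (λ _ → c)
  literal zero    = zeroᶜ , λ _ → ⇓zero
  literal (suc c) = sucᶜᵒ (literal c)

  pattern v0 = zero
  pattern v1 = suc zero
  pattern v2 = suc (suc zero)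
  pattern v3 = suc (suc (suc zero))
  pattern v4 = suc (suc (suc (suc zero)))
  pattern v5 = suc (suc (suc (suc (suc zero))))

  infixl 6 _⊕_ _⊖_
  infixl 7 _⊗_

  _⊕_ : Computable f → Computable g → Computable (λ xs → f xs + g xs)
  F ⊕ G = lift₂ {h = λ xs → lookup xs v0 + lookup xs v1}
    (ext (λ xs → eq (lookup xs v0) (lookup xs v1))
      (recursion (var v1) (sucᶜᵒ (var v1)) (var v0))) F G
    where
    eq : ∀ a b → natrec b (λ _ y → suc y) a ≡ a + b
    eq zero    b = refl
    eq (suc a) b = cong suc (eq a b)

  _⊗_ : Computable f → Computable g → Computable (λ xs → f xs * g xs)
  F ⊗ G = lift₂ {h = λ xs → lookup xs v0 * lookup xs v1}
    (ext (λ xs → eq (lookup xs v0) (lookup xs v1))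
      (recursion (literal 0) (var v3 ⊕ var v1) (var v0))) F G
    where
    eq : ∀ a b → natrec 0 (λ _ y → b + y) a ≡ a * b
    eq zero    b = refl
    eq (suc a) b = cong (b +_) (eq a b)

  predᶜᵒ : Computable f → Computable (λ xs → pred (f xs))
  predᶜᵒ = lift₁ {h = λ xs → pred (lookup xs v0)}
    (ext (λ xs → eq (lookup xs v0)) (recursion (literal 0) (var v0) (var v0)))
    where
    eq : ∀ a → natrec 0 (λ m _ → m) a ≡ pred a
    eq zero    = refl
    eq (suc a) = refl

  _⊖_ : Computable f → Computable g → Computable (λ xs → f xs ∸ g xs)
  F ⊖ G = lift₂ {h = λ xs → lookup xs v0 ∸ lookup xs v1}
    (ext (λ xs → eq (lookup xs v0) (lookup xs v1))
      (recursion (var v0) (predᶜᵒ (var v1)) (var v1))) F G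
    where
    eq : ∀ a b → natrec a (λ _ y → pred y) b ≡ a ∸ b
    eq a zero    = refl
    eq a (suc b) = trans (cong pred (eq a b)) (pred[m∸n]≡m∸[1+n] a b)

  2^ᶜᵒ : Computable f → Computable (λ xs → 2 ^ f xs)
  2^ᶜᵒ = lift₁ {h = λ xs → 2 ^ lookup xs v0}
    (ext (λ xs → eq (lookup xs v0)) (recursion (literal 1) (literal 2 ⊗ var v1) (var v0)))
    where
    eq : ∀ a → natrec 1 (λ _ y → 2 * y) a ≡ 2 ^ a
    eq zero    = refl
    eq (suc a) = cong (2 *_) (eq a)

  ifz : {A : Set} → ℕ → A → A → A
  ifz zero    a b = a
  ifz (suc _) a b = b

  ifzᶜᵒ : Computable f → Computable g → Computable h → Computable (λ xs → ifz (f xs) (g xs) (h xs))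
  ifzᶜᵒ {g = g} {h = h} F G (e , p) =
    ext (λ xs → eq (g xs) (h xs) _) (recursion {s = λ ys → h (drop2 ys)} G
      (comp e (skip₂) , λ { (m ∷ y ∷ xs) →
        ⇓comp (skip₂-⇓ m y xs) (p xs) }) F)
    where
    drop2 : ∀ {n} → Vec ℕ (suc (suc n)) → Vec ℕ n
    drop2 (_ ∷ _ ∷ xs) = xs
    eq : ∀ a b c → natrec a (λ _ _ → b) c ≡ ifz c a b
    eq a b zero    = refl
    eq a b (suc c) = refl

  ∑< : ℕ → (ℕ → ℕ) → ℕ
  ∑< n f = natrec 0 (λ m s → s + f m) n

  ∑<ᶜᵒ : {s : Vec ℕ (suc n) → ℕ} → Computable k → Computable s →
    Computable (λ xs → ∑< (k xs) (λ m → s (m ∷ xs)))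
  ∑<ᶜᵒ {s = s} K (e , p) = recursion {s = λ ys → lookup ys v1 + s (drop1 ys)} (literal 0)
    (var v1 ⊕ (comp e (proj v0 ∷ skip₂) , λ { (m ∷ y ∷ xs) →
      ⇓comp (⇓proj ∷ skip₂-⇓ m y xs) (p (m ∷ xs)) })) K
    where
    drop1 : ∀ {n} → Vec ℕ (suc (suc n)) → Vec ℕ (suc n)
    drop1 (m ∷ _ ∷ xs) = m ∷ xs

  ≤-test : ℕ → ℕ → ℕ
  ≤-test a b = 1 ∸ (a ∸ b)

  ≤-test-yes : ∀ {a b} → a ≤ b → ≤-test a b ≡ 1
  ≤-test-yes a≤b = cong (1 ∸_) (m≤n⇒m∸n≡0 a≤b)

  ≤-test-no : ∀ {a b} → b < a → ≤-test a b ≡ 0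
  ≤-test-no b<a = m≤n⇒m∸n≡0 (m<n⇒0<n∸m b<a)

  -- Summing an indicator that switches off once finds the switching point. This stands in for
  -- bounded search: n / c is the number of m with (m + 1) c ≤ n, and the length of a coded string
  -- is the number of t for which deleting t letters leaves something.
  ∑<-threshold : ∀ n p t → (∀ m → m < p → t m ≡ 1) → (∀ m → p ≤ m → t m ≡ 0) → p ≤ n → ∑< n t ≡ p
  ∑<-threshold zero    zero t below above z≤n = refl
  ∑<-threshold (suc n) p    t below above p≤1+n with m≤n⇒m<n∨m≡n p≤1+n
  ... | inj₁ (s≤s p≤n) rewrite above n p≤n = trans (+-identityʳ _) (∑<-threshold n p t below above p≤n)
  ... | inj₂ refl rewrite below n ≤-refl =
    trans (cong (_+ 1) (ones n (λ m m<n → below m (m<n⇒m<1+n m<n)))) (+-comm n 1)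
    where
    ones : ∀ n → (∀ m → m < n → t m ≡ 1) → ∑< n t ≡ n
    ones zero    _ = refl
    ones (suc n) b rewrite b n ≤-refl = trans (cong (_+ 1) (ones n (λ m m<n → b m (m<n⇒m<1+n m<n)))) (+-comm n 1)

  /ᶜᵒ : ∀ c .{{_ : NonZero c}} → Computable f → Computable (λ xs → f xs / c)
  /ᶜᵒ c = lift₁ {h = λ xs → lookup xs v0 / c} (ext (λ xs → eq (lookup xs v0))
    (∑<ᶜᵒ {s = λ ys → ≤-test (suc (lookup ys v0) * c) (lookup ys v1)} (var v0)
      (literal 1 ⊖ (sucᶜᵒ (var v0) ⊗ literal c ⊖ var v1))))
    where
    eq : ∀ n → ∑< n (λ m → ≤-test (suc m * c) n) ≡ n / c
    eq n = ∑<-threshold n (n / c) _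
      (λ m m<n/c → ≤-test-yes (≤-trans (*-monoˡ-≤ c m<n/c) (m/n*n≤m n c)))
      (λ m n/c≤m → ≤-test-no (≰⇒> λ le → <⇒≱ (subst (_≤ n / c) (m*n/n≡m (suc m) c) (/-monoˡ-≤ c le)) n/c≤m))
      (m/n≤m n c)

  %ᶜᵒ : ∀ c .{{_ : NonZero c}} → Computable f → Computable (λ xs → f xs % c)
  %ᶜᵒ {f = f} c F = ext (λ xs → sym (m%n≡m∸m/n*n (f xs) c)) (F ⊖ /ᶜᵒ c F ⊗ literal c)

  [r+q*n]/n≡q : ∀ n .{{_ : NonZero n}} q {r} → r < n → (r + q * n) / n ≡ q
  [r+q*n]/n≡q n q {r} r<n = trans (+-distrib-/-∣ʳ r (n∣m*n q)) (cong₂ _+_ (m<n⇒m/n≡0 r<n) (m*n/n≡m q n))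

  [r+q*n]%n≡r : ∀ n .{{_ : NonZero n}} q {r} → r < n → (r + q * n) % n ≡ r
  [r+q*n]%n≡r n q {r} r<n = trans ([m+kn]%n≡m%n r q n) (m<n⇒m%n≡m r<n)

  index-∷ʳ : ∀ {k} σ (a : Fin k) → index (σ ∷ʳ a) ≡ suc (toℕ a + index σ * k)
  index-∷ʳ {k} σ a = trans (foldl-∷ʳ _ 0 a σ)
    (cong suc (trans (+-comm _ (toℕ a)) (cong (toℕ a +_) (*-comm k (index σ)))))

  index-↾-suc : ∀ {k} (x : Seq k) n → index (x ↾ suc n) ≡ suc (toℕ (x n) + index (x ↾ n) * k)
  index-↾-suc x n = trans (cong index (sym (applyUpTo-∷ʳ x n))) (index-∷ʳ (x ↾ n) (x n))

  module _ {k} .{{_ : NonZero k}} (x : Seq k) where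

    -- In bijective base k a nonempty string has the code 1 + last letter + k times the code of the
    -- rest. After subtracting 1, the quotient deletes the last letter and the remainder reads it.
    pred-index-/ : ∀ n → pred (index (x ↾ suc n)) / k ≡ index (x ↾ n)
    pred-index-/ n rewrite index-↾-suc x n = [r+q*n]/n≡q k (index (x ↾ n)) (toℕ<n (x n))

    pred-index-% : ∀ n → pred (index (x ↾ suc n)) % k ≡ toℕ (x n)
    pred-index-% n rewrite index-↾-suc x n = [r+q*n]%n≡r k (index (x ↾ n)) (toℕ<n (x n))

    n≤index-↾ : ∀ n → n ≤ index (x ↾ n)
    n≤index-↾ zero = z≤n
    n≤index-↾ (suc n) rewrite index-↾-suc x n =
      s≤s (≤-trans (n≤index-↾ n) (≤-trans (m≤m*n (index (x ↾ n)) k) (m≤n+m _ (toℕ (x n)))))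

  -- A node that is still compatible with the target ζ carries what remains of ζ;
  -- it is `paused` if its own label is 2 and `fresh` otherwise.

  data Status : Set where
    dead   : Status
    fresh  : Str 2 → Status
    paused : Str 2 → Status

  -- The default pads an exhausted target with zeros. This agrees with `value`, where 0 has half 0
  -- and remainder 0, so the arithmetic need not know lengths; and since some bit always comes next,
  -- `π-advance` holds for every status.
  head₀ : Str 2 → Fin 2
  head₀ []      = zero
  head₀ (b ∷ _) = b

  tail₀ : Str 2 → Str 2
  tail₀ []      = []
  tail₀ (_ ∷ ζ) = ζ

  accept : Fin 2 → Fin 2 → Status → Status
  accept zero       zero       q = q
  accept (suc zero) (suc zero) q = q
  accept _          _          _ = dead

  emit : Fin 2 → Str 2 → Status
  emit a ζ = accept a (head₀ ζ) (fresh (tail₀ ζ))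

  -- Two consecutive labels 2 kill a node: every infinite surviving path then has
  -- infinite output, so that the survivors form a compact set.

  advance : Status → Fin 3 → Status
  advance dead       _          = dead
  advance (fresh ζ)  zero       = emit zero ζ
  advance (fresh ζ)  (suc zero) = emit (suc zero) ζ
  advance (fresh ζ)  v2         = paused ζ
  advance (paused ζ) zero       = emit zero ζ
  advance (paused ζ) (suc zero) = emit (suc zero) ζ
  advance (paused ζ) v2         = dead

  -- The head is the least significant digit, so halving drops it. Trailing zeros are invisible, but
  -- on strings of one length d this is a bijection onto the numbers below 2^d, which is what
  -- `∑<-value` uses.
  value : Str 2 → ℕ
  value []      = 0
  value (b ∷ ζ) = toℕ b + value ζ * 2

  -- Only `dead` has code 0, so a sum of codes vanishes exactly when every status in it is dead.
  -- This is why `aliveᴺ` and `survivors` add up codes instead of counting.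
  encode : Status → ℕ
  encode dead       = 0
  encode (fresh ζ)  = 1 + value ζ * 2
  encode (paused ζ) = 2 + value ζ * 2

  emitᴺ : ℕ → ℕ → ℕ
  emitᴺ a r = ifz ((a ∸ r % 2) + (r % 2 ∸ a)) (1 + r / 2 * 2) 0

  advanceᴺ : ℕ → ℕ → ℕ
  advanceᴺ q a = ifz q 0
    (ifz (2 ∸ a) (ifz (pred q % 2) (2 + pred q / 2 * 2) 0) (emitᴺ a (pred q / 2)))

  emitᴺ-value : ∀ a ζ → emitᴺ (toℕ a) (value ζ) ≡ encode (emit a ζ)
  emitᴺ-value zero       []       = refl
  emitᴺ-value (suc zero) []       = refl
  emitᴺ-value a          (b ∷ ζ)
    rewrite [r+q*n]/n≡q 2 (value ζ) (toℕ<n b) | [r+q*n]%n≡r 2 (value ζ) (toℕ<n b) = cases a b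
    where
    cases : ∀ a b → ifz ((toℕ a ∸ toℕ b) + (toℕ b ∸ toℕ a)) (1 + value ζ * 2) 0 ≡
                    encode (accept a b (fresh ζ))
    cases zero       zero       = refl
    cases zero       (suc zero) = refl
    cases (suc zero) zero       = refl
    cases (suc zero) (suc zero) = refl

  advanceᴺ-encode : ∀ q a → advanceᴺ (encode q) (toℕ a) ≡ encode (advance q a)
  advanceᴺ-encode dead _ = refl
  advanceᴺ-encode (fresh ζ) a
    rewrite [r+q*n]/n≡q 2 (value ζ) {0} z<s | [r+q*n]%n≡r 2 (value ζ) {0} z<s = cases a
    where
    cases : ∀ a → ifz (2 ∸ toℕ a) (2 + value ζ * 2) (emitᴺ (toℕ a) (value ζ)) ≡ encode (advance (fresh ζ) a)
    cases zero       = emitᴺ-value zero ζ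
    cases (suc zero) = emitᴺ-value (suc zero) ζ
    cases v2         = refl
  advanceᴺ-encode (paused ζ) a
    rewrite [r+q*n]/n≡q 2 (value ζ) {1} (s≤s z<s) | [r+q*n]%n≡r 2 (value ζ) {1} (s≤s z<s) = cases a
    where
    cases : ∀ a → ifz (2 ∸ toℕ a) 0 (emitᴺ (toℕ a) (value ζ)) ≡ encode (advance (paused ζ) a)
    cases zero       = emitᴺ-value zero ζ
    cases (suc zero) = emitᴺ-value (suc zero) ζ
    cases v2         = refl

  -- Folding along the branch from the root to a node, where nodes are numbered as
  -- in `index`: the parent of suc v is v / 2.

  module _ {A : Set} (root : A) (step : A → ℕ → A) where

    private
      fuelled : ℕ → ℕ → A
      fuelled zero    _       = root
      fuelled (suc t) zero    = root
      fuelled (suc t) (suc v) = step (fuelled t (v / 2)) (suc v)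

      fuelled-≥ : ∀ t u v → v ≤ t → v ≤ u → fuelled t v ≡ fuelled u v
      fuelled-≥ zero    zero    zero    _ _ = refl
      fuelled-≥ zero    (suc u) zero    _ _ = refl
      fuelled-≥ (suc t) zero    zero    _ _ = refl
      fuelled-≥ (suc t) (suc u) zero    _ _ = refl
      fuelled-≥ (suc t) (suc u) (suc v) (s≤s v≤t) (s≤s v≤u) = cong (λ a → step a (suc v))
        (fuelled-≥ t u (v / 2) (≤-trans (m/n≤m v 2) v≤t) (≤-trans (m/n≤m v 2) v≤u))

    branchFold : ℕ → A
    branchFold v = fuelled v v

    branchFold-suc : ∀ v → branchFold (suc v) ≡ step (branchFold (v / 2)) (suc v)
    branchFold-suc v = cong (λ a → step a (suc v)) (fuelled-≥ v (v / 2) (v / 2) (m/n≤m v 2) ≤-refl)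

  branch-induction : (P : ℕ → Set) → P 0 → (∀ v → P (v / 2) → P (suc v)) → ∀ v → P v
  branch-induction P base step = <-rec P λ where
    zero    _   → base
    (suc v) rec → step v (rec (s≤s (m/n≤m v 2)))

  -- Labels of the nodes up to N are ignored: below each of them the target is
  -- started afresh.

  module _ (x : Seq 3) (N : ℕ) (ζ : Str 2) where

    statusStep : Status → ℕ → Status
    statusStep q v = ifz (v ∸ N) (fresh ζ) (advance q (x (pred v)))

    status : ℕ → Status
    status = branchFold (fresh ζ) statusStep

    status-suc : ∀ v → status (suc v) ≡ statusStep (status (v / 2)) (suc v)
    status-suc = branchFold-suc (fresh ζ) statusStep

  ancestor : ℕ → ℕ → ℕ
  ancestor v = natrec v (λ _ u → pred u / 2)

  initial : ℕ → ℕ → ℕ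
  initial s = natrec s (λ _ u → pred u / 3)

  len : ℕ → ℕ
  len s = ∑< s (λ t → 1 ∸ (1 ∸ initial s t))

  labelᴺ : ℕ → ℕ → ℕ
  labelᴺ s v = pred (initial s (len s ∸ v)) % 3

  -- Primitive recursion cannot call itself at v / 2, so the branch is walked from the root down to
  -- v: after k rounds the value belongs to the ancestor v ∸ k steps above v. There are more rounds
  -- than nodes on the branch; the surplus ones stay at the root 0, which is reset because 0 ≤ N.
  statusᴺ : ℕ → ℕ → ℕ → ℕ → ℕ
  statusᴺ N s z v = natrec (1 + z * 2)
    (λ k q → ifz (ancestor v (v ∸ suc k) ∸ N) (1 + z * 2)
               (advanceᴺ q (labelᴺ s (ancestor v (v ∸ suc k))))) v

  -- After ℓ labels the nodes 1 + ℓ + j with j < 2 + ℓ are those next in line, below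
  -- the root or a labelled node; (ℓ + j) / 2 is the parent.

  aliveᴺ : ℕ → ℕ → ℕ → ℕ → ℕ
  aliveᴺ ℓ N s z = ∑< (2 + ℓ) (λ j → statusᴺ N s z ((ℓ + j) / 2))

  -- Makes 2 · (7/8)^(2 + N) at most 2^(-i), because (7/8)^6 ≤ 1/2.

  threshold : ℕ → ℕ
  threshold i = 4 + i * 6

  -- Truncated subtraction: 0 says that at least half of all targets of length ℓ
  -- are extinct.

  deficit : ℕ → ℕ → ℕ → ℕ
  deficit ℓ i s = 2 ^ ℓ ∸ 2 * ∑< (2 ^ ℓ) (λ z → 1 ∸ aliveᴺ ℓ (threshold i) s z)

  check : ℕ → ℕ → ℕ
  check i s = deficit (len s) i s

  check-computable : Computable {2} (λ xs → check (lookup xs v0) (lookup xs v1))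
  check-computable =
    2^ᶜᵒ (lenᶜᵒ (var v1)) ⊖ literal 2 ⊗ ∑<ᶜᵒ
      {s = λ ys → 1 ∸ aliveᴺ (len (lookup ys v2)) (threshold (lookup ys v1)) (lookup ys v2) (lookup ys v0)}
      (2^ᶜᵒ (lenᶜᵒ (var v1)))
      (literal 1 ⊖ ∑<ᶜᵒ
        {s = λ ys → statusᴺ (threshold (lookup ys v2)) (lookup ys v3) (lookup ys v1) ((len (lookup ys v3) + lookup ys v0) / 2)}
        (literal 2 ⊕ lenᶜᵒ (var v2))
        (statusᶜᵒ (literal 4 ⊕ var v2 ⊗ literal 6) (var v3) (var v1) (/ᶜᵒ 2 (lenᶜᵒ (var v3) ⊕ var v0))))
    where
    ancestorᶜᵒ : Computable f → Computable g → Computable (λ xs → ancestor (f xs) (g xs))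
    ancestorᶜᵒ = lift₂ {h = λ xs → ancestor (lookup xs v0) (lookup xs v1)}
      (recursion (var v0) (/ᶜᵒ 2 (predᶜᵒ (var v1))) (var v1))

    initialᶜᵒ : Computable f → Computable g → Computable (λ xs → initial (f xs) (g xs))
    initialᶜᵒ = lift₂ {h = λ xs → initial (lookup xs v0) (lookup xs v1)}
      (recursion (var v0) (/ᶜᵒ 3 (predᶜᵒ (var v1))) (var v1))

    lenᶜᵒ : Computable f → Computable (λ xs → len (f xs))
    lenᶜᵒ = lift₁ {h = λ xs → len (lookup xs v0)}
      (∑<ᶜᵒ {s = λ ys → 1 ∸ (1 ∸ initial (lookup ys v1) (lookup ys v0))} (var v0)
        (literal 1 ⊖ (literal 1 ⊖ initialᶜᵒ (var v1) (var v0))))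

    labelᶜᵒ : Computable f → Computable g → Computable (λ xs → labelᴺ (f xs) (g xs))
    labelᶜᵒ = lift₂ {h = λ xs → labelᴺ (lookup xs v0) (lookup xs v1)}
      (%ᶜᵒ 3 (predᶜᵒ (initialᶜᵒ (var v0) (lenᶜᵒ (var v0) ⊖ var v1))))

    emitᶜᵒ : Computable f → Computable g → Computable (λ xs → emitᴺ (f xs) (g xs))
    emitᶜᵒ = lift₂ {h = λ xs → emitᴺ (lookup xs v0) (lookup xs v1)}
      (ifzᶜᵒ ((var v0 ⊖ %ᶜᵒ 2 (var v1)) ⊕ (%ᶜᵒ 2 (var v1) ⊖ var v0))
        (literal 1 ⊕ /ᶜᵒ 2 (var v1) ⊗ literal 2) (literal 0))

    advanceᶜᵒ : Computable f → Computable g → Computable (λ xs → advanceᴺ (f xs) (g xs))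
    advanceᶜᵒ = lift₂ {h = λ xs → advanceᴺ (lookup xs v0) (lookup xs v1)}
      (ifzᶜᵒ (var v0) (literal 0)
        (ifzᶜᵒ (literal 2 ⊖ var v1)
          (ifzᶜᵒ (%ᶜᵒ 2 (predᶜᵒ (var v0))) (literal 2 ⊕ /ᶜᵒ 2 (predᶜᵒ (var v0)) ⊗ literal 2) (literal 0))
          (emitᶜᵒ (var v1) (/ᶜᵒ 2 (predᶜᵒ (var v0))))))

    statusᶜᵒ : Computable f → Computable g → Computable h → Computable k →
      Computable (λ xs → statusᴺ (f xs) (g xs) (h xs) (k xs))
    statusᶜᵒ = lift₄ {h = λ xs → statusᴺ (lookup xs v0) (lookup xs v1) (lookup xs v2) (lookup xs v3)}
      (recursion
        {s = λ ys → ifz (ancestor (lookup ys v5) (lookup ys v5 ∸ suc (lookup ys v0)) ∸ lookup ys v2) (1 + lookup ys v4 * 2)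
               (advanceᴺ (lookup ys v1) (labelᴺ (lookup ys v3) (ancestor (lookup ys v5) (lookup ys v5 ∸ suc (lookup ys v0)))))}
        (literal 1 ⊕ var v2 ⊗ literal 2)
        (ifzᶜᵒ (above ⊖ var v2) (literal 1 ⊕ var v4 ⊗ literal 2)
          (advanceᶜᵒ (var v1) (labelᶜᵒ (var v3) above)))
        (var v3))
      where
      above : Computable {6} (λ ys → ancestor (lookup ys v5) (lookup ys v5 ∸ suc (lookup ys v0)))
      above = ancestorᶜᵒ (var v5) (var v5 ⊖ sucᶜᵒ (var v0))

  -- Correctness of the arithmetical test

  ∑<-cong : ∀ n {s t} → (∀ m → m < n → s m ≡ t m) → ∑< n s ≡ ∑< n t
  ∑<-cong zero    s≗t = refl
  ∑<-cong (suc n) s≗t = cong₂ _+_ (∑<-cong n (λ m m<n → s≗t m (m<n⇒m<1+n m<n))) (s≗t n ≤-refl)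

  ∑<-double : ∀ n g → ∑< (2 * n) g ≡ ∑< n (λ m → g (m * 2)) + ∑< n (λ m → g (1 + m * 2))
  ∑<-double n g rewrite *-comm 2 n = go n
    where
    go : ∀ n → ∑< (n * 2) g ≡ ∑< n (λ m → g (m * 2)) + ∑< n (λ m → g (1 + m * 2))
    go zero    = refl
    go (suc n) rewrite go n = lemma (∑< n _) (∑< n _) (g (n * 2)) (g (1 + n * 2))
      where
      lemma : ∀ a b c d → a + b + c + d ≡ a + c + (b + d)
      lemma = solve-∀

  ∑Str : ℕ → (Str 2 → ℕ) → ℕ
  ∑Str zero    g = g []
  ∑Str (suc d) g = ∑Str d (λ ζ → g (zero ∷ ζ)) + ∑Str d (λ ζ → g (suc zero ∷ ζ))

  ∑<-value : ∀ d g → ∑< (2 ^ d) g ≡ ∑Str d (λ ζ → g (value ζ))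
  ∑<-value zero    g = refl
  ∑<-value (suc d) g = trans (∑<-double (2 ^ d) g)
    (cong₂ _+_ (∑<-value d (λ m → g (m * 2))) (∑<-value d (λ m → g (1 + m * 2))))

  ∑Str-cong : ∀ d {g h} → (∀ ζ → g ζ ≡ h ζ) → ∑Str d g ≡ ∑Str d h
  ∑Str-cong zero    g≗h = g≗h []
  ∑Str-cong (suc d) g≗h = cong₂ _+_ (∑Str-cong d (λ ζ → g≗h _)) (∑Str-cong d (λ ζ → g≗h _))

  suc-pred-∸ : ∀ {k v} → k < v → suc (v ∸ suc k) ≡ v ∸ k
  suc-pred-∸ {k} {suc v} (s≤s k≤v) = sym (+-∸-assoc 1 k≤v)

  ancestor-≤ : ∀ v t → ancestor v t ≤ v ∸ t
  ancestor-≤ v zero    = ≤-refl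
  ancestor-≤ v (suc t) = begin
    pred (ancestor v t) / 2  ≤⟨ m/n≤m _ 2 ⟩
    pred (ancestor v t)      ≤⟨ pred-mono-≤ (ancestor-≤ v t) ⟩
    pred (v ∸ t)             ≡⟨ pred[m∸n]≡m∸[1+n] v t ⟩
    v ∸ suc t                ∎
    where open ≤-Reasoning

  module _ (x : Seq 3) (L : ℕ) where

    private s = index (x ↾ L)

    initial-index : ∀ t → initial s t ≡ index (x ↾ (L ∸ t))
    initial-index zero    = refl
    initial-index (suc t) rewrite initial-index t | sym (pred[m∸n]≡m∸[1+n] L t) with L ∸ t
    ... | zero  = refl
    ... | suc m = pred-index-/ x m

    len-index : len s ≡ L
    len-index = ∑<-threshold s L _ below above (n≤index-↾ x L)
      where
      below : ∀ t → t < L → 1 ∸ (1 ∸ initial s t) ≡ 1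
      below t t<L rewrite initial-index t with L ∸ t | m<n⇒0<n∸m t<L
      ... | suc m | _ rewrite index-↾-suc x m = cong (1 ∸_) (0∸n≡0 (toℕ (x m) + index (x ↾ m) * 3))
      above : ∀ t → L ≤ t → 1 ∸ (1 ∸ initial s t) ≡ 0
      above t L≤t rewrite initial-index t | m≤n⇒m∸n≡0 L≤t = refl

    labelᴺ-index : ∀ v → suc v ≤ L → labelᴺ s (suc v) ≡ toℕ (x v)
    labelᴺ-index v v<L
      rewrite len-index | initial-index (L ∸ suc v) | m∸[m∸n]≡n v<L = pred-index-% x v

    module _ (N : ℕ) (ζ : Str 2) where

      statusᴺ-value : ∀ v → v ≤ L → statusᴺ N s (value ζ) v ≡ encode (status x N ζ v)
      statusᴺ-value v v≤L = trans (go v ≤-refl) (cong (λ t → encode (status x N ζ (ancestor v t))) (n∸n≡0 v))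
        where
        go : ∀ k → k ≤ v →
          natrec (1 + value ζ * 2)
            (λ k q → ifz (ancestor v (v ∸ suc k) ∸ N) (1 + value ζ * 2)
                       (advanceᴺ q (labelᴺ s (ancestor v (v ∸ suc k))))) k
          ≡ encode (status x N ζ (ancestor v (v ∸ k)))
        go zero    _ rewrite n≤0⇒n≡0 (subst (ancestor v v ≤_) (n∸n≡0 v) (ancestor-≤ v v)) = refl
        go (suc k) k<v rewrite go k (<⇒≤ k<v) | sym (suc-pred-∸ k<v)
          with ancestor v (v ∸ suc k) | ≤-trans (ancestor-≤ v (v ∸ suc k)) (m∸n≤m v (v ∸ suc k))
        ... | zero  | _ rewrite 0∸n≡0 N = refl
        ... | suc u | u<v rewrite labelᴺ-index u (≤-trans u<v v≤L) | status-suc x N ζ u with suc u ∸ N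
        ...   | zero  = refl
        ...   | suc _ = advanceᴺ-encode (status x N ζ (u / 2)) (x u)

    -- The parents (L + j) / 2 with j ≤ L + 1 are numbered at most L, so their statuses depend only
    -- on the L labels coded by `s`.
    check-index : ∀ i → check i s ≡ 2 ^ L ∸ 2 * ∑Str L (λ ζ →
      1 ∸ ∑< (2 + L) (λ j → encode (status x (threshold i) ζ ((L + j) / 2))))
    check-index i = trans (cong (λ ℓ → deficit ℓ i s) len-index) (cong (λ c → 2 ^ L ∸ 2 * c)
      (trans (∑<-value L _) (∑Str-cong L λ ζ → cong (1 ∸_) (∑<-cong (2 + L) λ j j<2+L →
        statusᴺ-value (threshold i) ζ _ (begin
          (L + j) / 2      ≤⟨ /-monoˡ-≤ 2 (+-monoʳ-≤ L (s≤s⁻¹ j<2+L)) ⟩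
          (L + suc L) / 2  ≡⟨ cong (_/ 2) (lemma L) ⟩
          (1 + L * 2) / 2  ≡⟨ [r+q*n]/n≡q 2 L (s≤s z<s) ⟩
          L ∎)))))
      where
      open ≤-Reasoning
      lemma : ∀ L → L + suc L ≡ 1 + L * 2
      lemma = solve-∀

open Computability

open import Data.Rational.Base
open import Data.Rational.Properties
open import Data.Rational.Solver using (module +-*-Solver)
open import Algebra.Definitions.RawSemiring +-*-rawSemiring using (_^_)

-- Averages over strings, and Kolmogorov's inequality

fromℕ : ℕ → ℚ
fromℕ zero    = 0ℚ
fromℕ (suc n) = 1ℚ + fromℕ n

fromℕ-+ : ∀ m n → fromℕ (m ℕ.+ n) ≡ fromℕ m + fromℕ n
fromℕ-+ zero    n = sym (+-identityˡ (fromℕ n))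
fromℕ-+ (suc m) n = trans (cong (1ℚ +_) (fromℕ-+ m n)) (sym (+-assoc 1ℚ (fromℕ m) (fromℕ n)))

0≤fromℕ : ∀ n → 0ℚ ≤ fromℕ n
0≤fromℕ zero    = ≤-refl
0≤fromℕ (suc n) = +-mono-≤ (nonNegative⁻¹ 1ℚ) (0≤fromℕ n)

fromℕ-mono-≤ : ∀ {m n} → m ℕ.≤ n → fromℕ m ≤ fromℕ n
fromℕ-mono-≤ {n = n} z≤n = 0≤fromℕ n
fromℕ-mono-≤ (s≤s m≤n)   = +-monoʳ-≤ 1ℚ (fromℕ-mono-≤ m≤n)

0≤* : ∀ {p q} → 0ℚ ≤ p → 0ℚ ≤ q → 0ℚ ≤ p * q
0≤* {p} {q} 0≤p 0≤q =
  nonNegative⁻¹ (p * q) {{nonNeg*nonNeg⇒nonNeg p {{nonNegative 0≤p}} q {{nonNegative 0≤q}}}}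

0≤^ : ∀ {p} n → 0ℚ ≤ p → 0ℚ ≤ p ^ n
0≤^ zero    0≤p = nonNegative⁻¹ 1ℚ
0≤^ (suc n) 0≤p = 0≤* 0≤p (0≤^ n 0≤p)

avg : ℕ → (Str 2 → ℚ) → ℚ
avg zero    g = g []
avg (suc d) g = ½ * (avg d (λ ζ → g (zero ∷ ζ)) + avg d (λ ζ → g (suc zero ∷ ζ)))

private
  ½*[p+p]≡p : ∀ p → ½ * (p + p) ≡ p
  ½*[p+p]≡p = solve 1 (λ p → con ½ :* (p :+ p) := p) refl
    where open +-*-Solver

avg-const : ∀ d q → avg d (λ _ → q) ≡ q
avg-const zero    q = refl
avg-const (suc d) q rewrite avg-const d q = ½*[p+p]≡p q

avg-mono : ∀ d {g h} → (∀ ζ → length ζ ≡ d → g ζ ≤ h ζ) → avg d g ≤ avg d h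
avg-mono zero    g≤h = g≤h [] refl
avg-mono (suc d) g≤h = *-monoˡ-≤-nonNeg ½ (+-mono-≤
  (avg-mono d (λ ζ eq → g≤h _ (cong suc eq))) (avg-mono d (λ ζ eq → g≤h _ (cong suc eq))))

avg-+ : ∀ d g h → avg d (λ ζ → g ζ + h ζ) ≡ avg d g + avg d h
avg-+ zero    g h = refl
avg-+ (suc d) g h = trans
  (cong₂ (λ p q → ½ * (p + q)) (avg-+ d (λ ζ → g (zero ∷ ζ)) (λ ζ → h (zero ∷ ζ)))
                               (avg-+ d (λ ζ → g (suc zero ∷ ζ)) (λ ζ → h (suc zero ∷ ζ))))
  (solve 4 (λ a b c d → con ½ :* ((a :+ b) :+ (c :+ d)) := con ½ :* (a :+ c) :+ con ½ :* (b :+ d)) refl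
    (avg d (λ ζ → g (zero ∷ ζ))) (avg d (λ ζ → h (zero ∷ ζ)))
    (avg d (λ ζ → g (suc zero ∷ ζ))) (avg d (λ ζ → h (suc zero ∷ ζ))))
  where open +-*-Solver

avg-* : ∀ d r g → avg d (λ ζ → r * g ζ) ≡ r * avg d g
avg-* zero    r g = refl
avg-* (suc d) r g = trans
  (cong₂ (λ p q → ½ * (p + q)) (avg-* d r (λ ζ → g (zero ∷ ζ))) (avg-* d r (λ ζ → g (suc zero ∷ ζ))))
  (solve 3 (λ r a b → con ½ :* (r :* a :+ r :* b) := r :* (con ½ :* (a :+ b))) refl
    r (avg d (λ ζ → g (zero ∷ ζ))) (avg d (λ ζ → g (suc zero ∷ ζ))))
  where open +-*-Solver

avg-nonNeg : ∀ d {g} → (∀ ζ → 0ℚ ≤ g ζ) → 0ℚ ≤ avg d g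
avg-nonNeg d {g} 0≤g = subst (_≤ avg d g) (avg-const d 0ℚ) (avg-mono d (λ ζ _ → 0≤g ζ))

-- Every string of length d has equally many prolongations of length d + e, so a lower bound that
-- persists under prolongation passes to the finer average.
avg-extend : ∀ d e {g h} → (∀ ζ η → length ζ ≡ d → g ζ ≤ h (ζ ++ η)) → avg d g ≤ avg (d ℕ.+ e) h
avg-extend zero    e {g} g≤h = subst (_≤ _) (avg-const e (g [])) (avg-mono e (λ η _ → g≤h [] η refl))
avg-extend (suc d) e g≤h = *-monoˡ-≤-nonNeg ½ (+-mono-≤
  (avg-extend d e (λ ζ η eq → g≤h _ η (cong suc eq))) (avg-extend d e (λ ζ η eq → g≤h _ η (cong suc eq))))

avg-∑Str : ∀ d g → ½ ^ d * fromℕ (∑Str d g) ≡ avg d (λ ζ → fromℕ (g ζ))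
avg-∑Str zero    g = *-identityˡ (fromℕ (g []))
avg-∑Str (suc d) g = trans
  (cong (½ ^ suc d *_) (fromℕ-+ (∑Str d (λ ζ → g (zero ∷ ζ))) (∑Str d (λ ζ → g (suc zero ∷ ζ)))))
  (trans
    (solve 4 (λ h p a b → (h :* p) :* (a :+ b) := h :* (p :* a :+ p :* b)) refl ½ (½ ^ d)
      (fromℕ (∑Str d (λ ζ → g (zero ∷ ζ)))) (fromℕ (∑Str d (λ ζ → g (suc zero ∷ ζ)))))
    (cong₂ (λ p q → ½ * (p + q)) (avg-∑Str d (λ ζ → g (zero ∷ ζ))) (avg-∑Str d (λ ζ → g (suc zero ∷ ζ)))))
  where open +-*-Solver

½^d*2^d≡1 : ∀ d → ½ ^ d * fromℕ (2 ℕ.^ d) ≡ 1ℚ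
½^d*2^d≡1 zero    = refl
½^d*2^d≡1 (suc d) = begin
  ½ * ½ ^ d * fromℕ (2 ℕ.* 2 ℕ.^ d)
    ≡⟨ cong (λ n → ½ * ½ ^ d * fromℕ (2 ℕ.^ d ℕ.+ n)) (ℕ.+-identityʳ (2 ℕ.^ d)) ⟩
  ½ * ½ ^ d * fromℕ (2 ℕ.^ d ℕ.+ 2 ℕ.^ d)
    ≡⟨ cong (½ * ½ ^ d *_) (fromℕ-+ (2 ℕ.^ d) (2 ℕ.^ d)) ⟩
  ½ * ½ ^ d * (fromℕ (2 ℕ.^ d) + fromℕ (2 ℕ.^ d))
    ≡⟨ solve 2 (λ p a → (con ½ :* p) :* (a :+ a) := p :* a) refl (½ ^ d) (fromℕ (2 ℕ.^ d)) ⟩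
  ½ ^ d * fromℕ (2 ℕ.^ d)
    ≡⟨ ½^d*2^d≡1 d ⟩
  1ℚ ∎
  where
  open ≡-Reasoning
  open +-*-Solver

module _ (d : ℕ) (g : Str 2 → ℕ) where

  private
    ½^d*2∑ : ½ ^ d * fromℕ (2 ℕ.* ∑Str d g) ≡ avg d (λ ζ → fromℕ (g ζ)) + avg d (λ ζ → fromℕ (g ζ))
    ½^d*2∑ = begin
      ½ ^ d * fromℕ (s ℕ.+ (s ℕ.+ 0))          ≡⟨ cong (λ n → ½ ^ d * fromℕ (s ℕ.+ n)) (ℕ.+-identityʳ s) ⟩
      ½ ^ d * fromℕ (s ℕ.+ s)                  ≡⟨ cong (½ ^ d *_) (fromℕ-+ s s) ⟩
      ½ ^ d * (fromℕ s + fromℕ s)              ≡⟨ *-distribˡ-+ (½ ^ d) (fromℕ s) (fromℕ s) ⟩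
      ½ ^ d * fromℕ s + ½ ^ d * fromℕ s        ≡⟨ cong₂ _+_ (avg-∑Str d g) (avg-∑Str d g) ⟩
      avg d (λ ζ → fromℕ (g ζ)) + avg d (λ ζ → fromℕ (g ζ)) ∎
      where
      open ≡-Reasoning
      s = ∑Str d g

    scale : ∀ {m n} → m ℕ.≤ n → ½ ^ d * fromℕ m ≤ ½ ^ d * fromℕ n
    scale m≤n = *-monoˡ-≤-nonNeg (½ ^ d) {{nonNegative (0≤^ d (nonNegative⁻¹ ½))}} (fromℕ-mono-≤ m≤n)

  2^d≤2∑⇒½≤avg : 2 ℕ.^ d ℕ.≤ 2 ℕ.* ∑Str d g → ½ ≤ avg d (λ ζ → fromℕ (g ζ))
  2^d≤2∑⇒½≤avg le = subst (½ ≤_) (½*[p+p]≡p _)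
    (*-monoˡ-≤-nonNeg ½ {1ℚ} (subst₂ _≤_ (½^d*2^d≡1 d) ½^d*2∑ (scale le)))

  ½<avg⇒2^d≤2∑ : ½ < avg d (λ ζ → fromℕ (g ζ)) → 2 ℕ.^ d ℕ.≤ 2 ℕ.* ∑Str d g
  ½<avg⇒2^d≤2∑ ½<avg with 2 ℕ.^ d ℕ.≤? 2 ℕ.* ∑Str d g
  ... | yes le = le
  ... | no  nle = ⊥-elim (<-irrefl refl (<-≤-trans ½<avg
    (subst (_≤ ½) (½*[p+p]≡p _)
      (*-monoˡ-≤-nonNeg ½ {_} {1ℚ} (subst₂ _≤_ ½^d*2∑ (½^d*2^d≡1 d) (scale (ℕ.≰⇒≥ nle)))))))

∑ : ∀ {A : Set} → (A → ℚ) → List A → ℚ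
∑ g = foldr (λ a s → g a + s) 0ℚ

total : List (Maybe (Str 3)) → ℚ
total = ∑ weight

OnJust : ∀ {A : Set} → (A → Set) → Maybe A → Set
OnJust P m = ∀ σ → m ≡ just σ → P σ

infix 4 _⊑_
_⊑_ : ∀ {k} → Str k → Str k → Set
σ ⊑ τ = ∃ λ ρ → σ ++ ρ ≡ τ

-- As `⊑` is reflexive, this also forbids the same string at two places of a list.
Incomparable : Maybe (Str 3) → Maybe (Str 3) → Set
Incomparable m n = OnJust (λ σ → OnJust (λ τ → ¬ σ ⊑ τ × ¬ τ ⊑ σ) n) m

strip : Fin 3 → Maybe (Str 3) → Maybe (Str 3)
strip a nothing        = nothing
strip a (just [])      = nothing
strip a (just (b ∷ σ)) with a Fin.≟ b
... | yes _ = just σ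
... | no  _ = nothing

strip-just : ∀ a m {σ} → strip a m ≡ just σ → m ≡ just (a ∷ σ)
strip-just a (just (b ∷ σ)) eq with a Fin.≟ b
strip-just a (just (a ∷ σ)) refl | yes refl = refl

⅓ : ℚ
⅓ = ℤ.+ 1 / 3

weight-strip : ∀ m → m ≢ just [] →
  weight m ≡ ⅓ * (weight (strip zero m) + (weight (strip (suc zero) m) + weight (strip (suc (suc zero)) m)))
weight-strip nothing m≢ = refl
weight-strip (just []) m≢ = ⊥-elim (m≢ refl)
weight-strip (just (zero ∷ σ)) m≢ = cong (⅓ *_) (sym (+-identityʳ (⅓ ^ length σ)))
weight-strip (just (suc zero ∷ σ)) m≢ =
  cong (⅓ *_) (sym (trans (+-identityˡ _) (+-identityʳ (⅓ ^ length σ))))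
weight-strip (just (suc (suc zero) ∷ σ)) m≢ =
  cong (⅓ *_) (sym (trans (+-identityˡ _) (+-identityˡ (⅓ ^ length σ))))

total-strip : ∀ ms → All (_≢ just []) ms →
  total ms ≡ ⅓ * (total (map (strip zero) ms) + (total (map (strip (suc zero)) ms) + total (map (strip (suc (suc zero))) ms)))
total-strip []       []         = refl
total-strip (m ∷ ms) (m≢ ∷ ms≢) = trans (cong₂ _+_ (weight-strip m m≢) (total-strip ms ms≢))
  (solve 6 (λ a b c a′ b′ c′ → con ⅓ :* (a :+ (b :+ c)) :+ con ⅓ :* (a′ :+ (b′ :+ c′)) :=
      con ⅓ :* ((a :+ a′) :+ ((b :+ b′) :+ (c :+ c′)))) refl
    (weight (strip zero m)) (weight (strip (suc zero) m)) (weight (strip (suc (suc zero)) m))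
    (total (map (strip zero) ms)) (total (map (strip (suc zero)) ms)) (total (map (strip (suc (suc zero))) ms)))
  where open +-*-Solver

total-empty : ∀ {ms} → All (OnJust (λ _ → ⊥)) ms → total ms ≡ 0ℚ
total-empty [] = refl
total-empty {nothing ∷ ms} (_ ∷ ps) = trans (+-identityˡ _) (total-empty ps)
total-empty {just σ ∷ ms}  (p ∷ ps) = ⊥-elim (p σ refl)

total-root : ∀ {ms} → AllPairs Incomparable ms → Any (_≡ just []) ms → total ms ≡ 1ℚ
total-root (r ∷ rs) (here refl) =
  trans (cong (1ℚ +_) (total-empty (All.map (λ inc σ eq → proj₁ (inc [] refl σ eq) (σ , refl)) r))) (+-identityʳ 1ℚ)
total-root {nothing ∷ ms} (_ ∷ rs) (there p) = trans (+-identityˡ _) (total-root rs p)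
total-root {just σ ∷ ms}  (r ∷ rs) (there p) =
  ⊥-elim (All.lookupWith (λ inc eq → proj₂ (inc σ refl [] eq) (σ , refl)) r p)

root? : ∀ (ms : List (Maybe (Str 3))) → Any (_≡ just []) ms ⊎ All (_≢ just []) ms
root? []                   = inj₂ []
root? (just [] ∷ ms)       = inj₁ (here refl)
root? (nothing ∷ ms) with root? ms
... | inj₁ p = inj₁ (there p)
... | inj₂ q = inj₂ ((λ ()) ∷ q)
root? (just (_ ∷ _) ∷ ms) with root? ms
... | inj₁ p = inj₁ (there p)
... | inj₂ q = inj₂ ((λ ()) ∷ q)

Supermartingale : (Str 3 → ℚ) → Set
Supermartingale D = ∀ σ → ⅓ * (D (σ ∷ʳ zero) + (D (σ ∷ʳ suc zero) + D (σ ∷ʳ suc (suc zero)))) ≤ D σ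

-- Induction on the length bound. If the root occurs, incomparability makes it the only string, of
-- weight 1, and θ ≤ D [] is given. Otherwise the family splits along the first letter, and the
-- supermartingale inequality at the root collects the three parts.
kolmogorov-inequality : ∀ L ms {D} θ → Supermartingale D → (∀ σ → 0ℚ ≤ D σ) → AllPairs Incomparable ms →
  All (OnJust (λ σ → length σ ℕ.< L × θ ≤ D σ)) ms → θ * total ms ≤ D []
kolmogorov-inequality zero ms {D} θ _ 0≤D _ short = subst (_≤ D [])
  (sym (trans (cong (θ *_) (total-empty (All.map (λ s σ eq → ℕ.n≮0 (proj₁ (s σ eq))) short))) (*-zeroʳ θ)))
  (0≤D [])
kolmogorov-inequality (suc L) ms {D} θ super 0≤D inc short with root? ms
... | inj₁ p = subst (_≤ D []) (sym (trans (cong (θ *_) (total-root inc p)) (*-identityʳ θ)))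
  (All.lookupWith (λ s eq → proj₂ (s [] eq)) short p)
... | inj₂ q = begin
  θ * total ms                     ≡⟨ cong (θ *_) (total-strip ms q) ⟩
  θ * (⅓ * (t zero + (t (suc zero) + t (suc (suc zero)))))
    ≡⟨ solve 4 (λ θ a b c → θ :* (con ⅓ :* (a :+ (b :+ c))) := con ⅓ :* (θ :* a :+ (θ :* b :+ θ :* c))) refl
         θ (t zero) (t (suc zero)) (t (suc (suc zero))) ⟩
  ⅓ * (θ * t zero + (θ * t (suc zero) + θ * t (suc (suc zero))))
    ≤⟨ *-monoˡ-≤-nonNeg ⅓ (+-mono-≤ (below zero) (+-mono-≤ (below (suc zero)) (below (suc (suc zero))))) ⟩
  ⅓ * (D (zero ∷ []) + (D (suc zero ∷ []) + D (suc (suc zero) ∷ []))) ≤⟨ super [] ⟩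
  D [] ∎
  where
  open ≤-Reasoning
  open +-*-Solver
  t : Fin 3 → ℚ
  t a = total (map (strip a) ms)
  below : ∀ a → θ * t a ≤ D (a ∷ [])
  below a = kolmogorov-inequality L (map (strip a) ms) θ (λ σ → super (a ∷ σ)) (λ σ → 0≤D (a ∷ σ))
    (AllPairs.map⁺ (AllPairs.map (λ {m} {n} i σ eq τ eq′ →
      (λ { (ρ , refl) → proj₁ (i (a ∷ σ) (strip-just a m eq) (a ∷ τ) (strip-just a n eq′)) (ρ , refl) }) ,
      (λ { (ρ , refl) → proj₂ (i (a ∷ σ) (strip-just a m eq) (a ∷ τ) (strip-just a n eq′)) (ρ , refl) })) inc))
    (All.map⁺ (All.map (λ {m} s σ eq → ℕ.s≤s⁻¹ (proj₁ (s (a ∷ σ) (strip-just a m eq))) , proj₂ (s (a ∷ σ) (strip-just a m eq))) short))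

-- The extinction martingale

⅞ : ℚ
⅞ = ℤ.+ 7 / 8

-- The probabilities 1, ⅞, 59/64 are super-solutions of the equations for the
-- extinction probability of the subtree below a child of a node with the
-- given status.

π : Status → ℚ
π dead       = 1ℚ
π (fresh _)  = ⅞
π (paused _) = ℤ.+ 59 / 64

0≤π : ∀ q → 0ℚ ≤ π q
0≤π dead       = nonNegative⁻¹ _
0≤π (fresh _)  = nonNegative⁻¹ _
0≤π (paused _) = nonNegative⁻¹ _

π² : Status → ℚ
π² q = π q * π q

-- Exactly one of the labels 0 and 1 agrees with the next bit of the target, so the sum does not
-- depend on that bit.
accept-sum : ∀ (f : Status → ℚ) b q r →
  f (accept zero b q) + (f (accept (suc zero) b q) + r) ≡ f dead + (f q + r)
accept-sum f (suc zero) q r = refl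
accept-sum f zero       q r = begin
  f q + (f dead + r)  ≡⟨ +-assoc (f q) (f dead) r ⟨
  f q + f dead + r    ≡⟨ cong (_+ r) (+-comm (f q) (f dead)) ⟩
  f dead + f q + r    ≡⟨ +-assoc (f dead) (f q) r ⟩
  f dead + (f q + r)  ∎
  where open ≡-Reasoning

-- Once a node has its label, the subtrees below its two children are independent, hence the
-- squares. For `paused` there is equality: (1 + 49/64 + 1) / 3 = 59/64. For `fresh`, (1 + 49/64 +
-- (59/64)^2) / 3 is about 0.872, just below 7/8.
π-advance : ∀ q → ⅓ * (π² (advance q zero) + (π² (advance q (suc zero)) + π² (advance q (suc (suc zero))))) ≤ π q
π-advance dead       = ≤ᵇ⇒≤ _
π-advance (fresh ζ)  = subst (λ p → ⅓ * p ≤ ⅞)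
  (sym (accept-sum π² (head₀ ζ) (fresh (tail₀ ζ)) (π² (paused ζ)))) (≤ᵇ⇒≤ _)
π-advance (paused ζ) = subst (λ p → ⅓ * p ≤ ℤ.+ 59 / 64)
  (sym (accept-sum π² (head₀ ζ) (fresh (tail₀ ζ)) 1ℚ)) (≤ᵇ⇒≤ _)

∏π : List Status → ℚ
∏π = foldr (λ q p → π q * p) 1ℚ

∏π-++ : ∀ Q r → ∏π (Q ++ r ∷ r ∷ []) ≡ ∏π Q * π² r
∏π-++ [] r = solve 1 (λ p → p :* (p :* con 1ℚ) := con 1ℚ :* (p :* p)) refl (π r)
  where open +-*-Solver
∏π-++ (q ∷ Q) r = trans (cong (π q *_) (∏π-++ Q r)) (sym (*-assoc (π q) (∏π Q) (π² r)))

0≤∏π : ∀ Q → 0ℚ ≤ ∏π Q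
0≤∏π []      = nonNegative⁻¹ 1ℚ
0≤∏π (q ∷ Q) = 0≤* (0≤π q) (0≤∏π Q)

-- Labels are read in the order of the nodes, and the queue lists, for each node
-- that is waiting for its label, the status of its parent.  The counter is the
-- number of labels still to be ignored.

State : Set
State = ℕ × List Status

module _ (ζ : Str 2) where

  read : State → Fin 3 → State
  read (n     , [])    a = n , []
  read (zero  , q ∷ Q) a = zero , Q ++ advance q a ∷ advance q a ∷ []
  read (suc n , q ∷ Q) a = n , Q ++ fresh ζ ∷ fresh ζ ∷ []

  -- Ignored labels have a predictable effect, so the remaining resets are carried out in advance
  -- and the product is taken over the queue that results. Each reset trades one waiting node for
  -- two fresh ones, which turns the two initial ones into 2 + N.
  potential : ℕ → List Status → ℚ
  potential zero    Q       = ∏π Q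
  potential (suc n) []      = 1ℚ
  potential (suc n) (q ∷ Q) = potential n (Q ++ fresh ζ ∷ fresh ζ ∷ [])

  pot : State → ℚ
  pot (n , Q) = potential n Q

  0≤pot : ∀ s → 0ℚ ≤ pot s
  0≤pot (n , Q) = go n Q
    where
    go : ∀ n Q → 0ℚ ≤ potential n Q
    go zero    Q       = 0≤∏π Q
    go (suc n) []      = nonNegative⁻¹ 1ℚ
    go (suc n) (q ∷ Q) = go n (Q ++ fresh ζ ∷ fresh ζ ∷ [])

  private
    average-const : ∀ p → ⅓ * (p + (p + p)) ≤ p
    average-const p = ≤-reflexive (solve 1 (λ p → con ⅓ :* (p :+ (p :+ p)) := p) refl p)
      where open +-*-Solver

  pot-read : ∀ s → ⅓ * (pot (read s zero) + (pot (read s (suc zero)) + pot (read s (suc (suc zero))))) ≤ pot s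
  pot-read (zero  , [])    = average-const _
  pot-read (suc n , [])    = average-const _
  pot-read (suc n , q ∷ Q) = average-const _
  pot-read (zero  , q ∷ Q) = begin
    ⅓ * (f zero + (f (suc zero) + f (suc (suc zero))))
      ≡⟨ cong (⅓ *_) (cong₂ _+_ (∏π-++ Q _) (cong₂ _+_ (∏π-++ Q _) (∏π-++ Q _))) ⟩
    ⅓ * (∏π Q * g zero + (∏π Q * g (suc zero) + ∏π Q * g (suc (suc zero))))
      ≡⟨ solve 4 (λ p a b c → con ⅓ :* (p :* a :+ (p :* b :+ p :* c)) := (con ⅓ :* (a :+ (b :+ c))) :* p) refl
           (∏π Q) (g zero) (g (suc zero)) (g (suc (suc zero))) ⟩
    ⅓ * (g zero + (g (suc zero) + g (suc (suc zero)))) * ∏π Q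
      ≤⟨ *-monoʳ-≤-nonNeg (∏π Q) {{nonNegative (0≤∏π Q)}} (π-advance q) ⟩
    π q * ∏π Q ∎
    where
    open ≤-Reasoning
    open +-*-Solver
    f g : Fin 3 → ℚ
    f a = ∏π (Q ++ advance q a ∷ advance q a ∷ [])
    g a = π² (advance q a)

  start : ℕ → State
  start N = N , fresh ζ ∷ fresh ζ ∷ []

  pot-start : ∀ N → pot (start N) ≡ ⅞ ^ (2 ℕ.+ N)
  pot-start N = trans (go N 1) (cong (⅞ ^_) (ℕ.+-comm N 2))
    where
    ∏π-replicate : ∀ l → ∏π (replicate l (fresh ζ)) ≡ ⅞ ^ l
    ∏π-replicate zero    = refl
    ∏π-replicate (suc l) = cong (⅞ *_) (∏π-replicate l)
    snoc² : ∀ l → replicate l (fresh ζ) ++ fresh ζ ∷ fresh ζ ∷ [] ≡ replicate (2 ℕ.+ l) (fresh ζ)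
    snoc² zero    = refl
    snoc² (suc l) = cong (fresh ζ ∷_) (snoc² l)
    go : ∀ n l → potential n (replicate (suc l) (fresh ζ)) ≡ ⅞ ^ (n ℕ.+ suc l)
    go zero    l = ∏π-replicate (suc l)
    go (suc n) l rewrite snoc² l = trans (go n (suc l)) (cong (⅞ ^_) (ℕ.+-suc n (suc l)))

  run : ℕ → Str 3 → State
  run N = foldl read (start N)

extinction : ℕ → ℕ → Str 3 → ℚ
extinction N d σ = avg d (λ ζ → pot ζ (run ζ N σ))

extinction-[] : ∀ N d → extinction N d [] ≡ ⅞ ^ (2 ℕ.+ N)
extinction-[] N d = ≤-antisym
  (subst (extinction N d [] ≤_) (avg-const d _) (avg-mono d (λ ζ _ → ≤-reflexive (pot-start ζ N))))
  (subst (_≤ extinction N d []) (avg-const d _) (avg-mono d (λ ζ _ → ≤-reflexive (sym (pot-start ζ N)))))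

0≤extinction : ∀ N d σ → 0ℚ ≤ extinction N d σ
0≤extinction N d σ = avg-nonNeg d (λ ζ → 0≤pot ζ (run ζ N σ))

extinction-supermartingale : ∀ N d → Supermartingale (extinction N d)
extinction-supermartingale N d σ = subst (_≤ extinction N d σ) linear
  (avg-mono d λ ζ _ → subst (λ p → p ≤ pot ζ (run ζ N σ))
    (cong (⅓ *_) (cong₂ _+_ (after ζ zero) (cong₂ _+_ (after ζ (suc zero)) (after ζ (suc (suc zero))))))
    (pot-read ζ (run ζ N σ)))
  where
  g : Fin 3 → Str 2 → ℚ
  g a ζ = pot ζ (run ζ N (σ ∷ʳ a))
  after : ∀ ζ a → pot ζ (read ζ (run ζ N σ) a) ≡ g a ζ
  after ζ a = cong (pot ζ) (sym (foldl-∷ʳ (read ζ) (start ζ N) a σ))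
  linear : avg d (λ ζ → ⅓ * (g zero ζ + (g (suc zero) ζ + g (suc (suc zero)) ζ))) ≡
           ⅓ * (avg d (g zero) + (avg d (g (suc zero)) + avg d (g (suc (suc zero)))))
  linear = trans (avg-* d ⅓ _) (cong (⅓ *_)
    (trans (avg-+ d (g zero) _) (cong (avg d (g zero) +_) (avg-+ d (g (suc zero)) (g (suc (suc zero)))))))

applyUpTo-cong : ∀ {A : Set} {f g : ℕ → A} n → (∀ i → f i ≡ g i) → applyUpTo f n ≡ applyUpTo g n
applyUpTo-cong zero    f≗g = refl
applyUpTo-cong (suc n) f≗g = cong₂ _∷_ (f≗g 0) (applyUpTo-cong n (λ i → f≗g (suc i)))

∑<≡0 : ∀ n {s} → ∑< n s ≡ 0 → ∀ j → j ℕ.< n → s j ≡ 0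
∑<≡0 (suc n) {s} eq j j<1+n with ℕ.m≤n⇒m<n∨m≡n (s≤s⁻¹ j<1+n)
... | inj₁ j<n  = ∑<≡0 n (ℕ.m+n≡0⇒m≡0 _ eq) j j<n
... | inj₂ refl = ℕ.m+n≡0⇒n≡0 (∑< n s) eq

encode≡0 : ∀ q → encode q ≡ 0 → q ≡ dead
encode≡0 dead _ = refl

-- As long as the target is not exhausted, prolonging it only prolongs what remains.

data Extends (η : Str 2) (v l : ℕ) : Status → Status → Set where
  both-dead   : Extends η v l dead dead
  both-fresh  : ∀ {ρ} → l ℕ.≤ length ρ ℕ.+ v → Extends η v l (fresh ρ) (fresh (ρ ++ η))
  both-paused : ∀ {ρ} → l ℕ.≤ length ρ ℕ.+ v → Extends η v l (paused ρ) (paused (ρ ++ η))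

-- The bound l ≤ length ρ + v says that at most v of the l letters have been used by node v. With v
-- < l a genuine letter is left, and the padding of `head₀` is not reached.
emit-extends : ∀ a ρ {η v l} → suc v ℕ.≤ l → l ℕ.≤ length ρ ℕ.+ v →
  Extends η (suc v) l (emit a ρ) (emit a (ρ ++ η))
emit-extends a [] v<l l≤ = ⊥-elim (ℕ.<⇒≱ v<l l≤)
emit-extends a (b ∷ ρ) {v = v} v<l l≤ = accepts a b
  where
  l≤′ = ℕ.≤-trans l≤ (ℕ.≤-reflexive (sym (ℕ.+-suc (length ρ) v)))
  accepts : ∀ a b → Extends _ (suc v) _ (accept a b (fresh ρ)) (accept a b (fresh (ρ ++ _)))
  accepts zero       zero       = both-fresh l≤′
  accepts zero       (suc zero) = both-dead
  accepts (suc zero) zero       = both-dead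
  accepts (suc zero) (suc zero) = both-fresh l≤′

advance-extends : ∀ a {η v l q q′} → suc v ℕ.≤ l → Extends η v l q q′ →
  Extends η (suc v) l (advance q a) (advance q′ a)
advance-extends a          v<l both-dead = both-dead
advance-extends zero       v<l (both-fresh {ρ} l≤)  = emit-extends zero ρ v<l l≤
advance-extends (suc zero) v<l (both-fresh {ρ} l≤)  = emit-extends (suc zero) ρ v<l l≤
advance-extends v2         v<l (both-fresh {ρ} l≤)  = both-paused (ℕ.≤-trans l≤ (ℕ.+-monoʳ-≤ (length ρ) (ℕ.n≤1+n _)))
advance-extends zero       v<l (both-paused {ρ} l≤) = emit-extends zero ρ v<l l≤
advance-extends (suc zero) v<l (both-paused {ρ} l≤) = emit-extends (suc zero) ρ v<l l≤
advance-extends v2         v<l (both-paused l≤)     = both-dead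

extends-≤ : ∀ {η u v l q q′} → u ℕ.≤ v → Extends η u l q q′ → Extends η v l q q′
extends-≤ u≤v both-dead            = both-dead
extends-≤ u≤v (both-fresh {ρ} l≤)  = both-fresh (ℕ.≤-trans l≤ (ℕ.+-monoʳ-≤ (length ρ) u≤v))
extends-≤ u≤v (both-paused {ρ} l≤) = both-paused (ℕ.≤-trans l≤ (ℕ.+-monoʳ-≤ (length ρ) u≤v))

-- The queue compared with the statuses of the nodes

module _ (x : Seq 3) (N : ℕ) where

  frontier : Str 2 → ℕ → ℕ → Status
  frontier ζ k j = status x N ζ ((k ℕ.+ j) ℕ./ 2)

  -- The label `x k` belongs to node k + 1, whose parent heads the queue. Afterwards node k + 1 is
  -- appended twice, as the parent of 2k + 3 and 2k + 4; these are the positions j = k + 1 and j = k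
  -- + 2 of the next frontier.
  run-↾ : ∀ ζ k → run ζ N (x ↾ k) ≡ (N ℕ.∸ k , applyUpTo (frontier ζ k) (2 ℕ.+ k))
  run-↾ ζ zero = refl
  run-↾ ζ (suc k) = begin
    run ζ N (x ↾ suc k)
      ≡⟨ cong (run ζ N) (applyUpTo-∷ʳ x k) ⟨
    run ζ N (x ↾ k ∷ʳ x k)
      ≡⟨ foldl-∷ʳ (read ζ) (start ζ N) (x k) (x ↾ k) ⟩
    read ζ (run ζ N (x ↾ k)) (x k)
      ≡⟨ cong (λ s → read ζ s (x k)) (run-↾ ζ k) ⟩
    read ζ (N ℕ.∸ k , frontier ζ k 0 ∷ applyUpTo (λ j → frontier ζ k (suc j)) (suc k)) (x k)
      ≡⟨ popped ⟩
    (N ℕ.∸ suc k , applyUpTo (λ j → frontier ζ k (suc j)) (suc k) ++ r ∷ r ∷ [])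
      ≡⟨ cong (λ Q → N ℕ.∸ suc k , Q ++ r ∷ r ∷ []) (applyUpTo-cong (suc k) (λ j →
           cong (λ m → status x N ζ (m ℕ./ 2)) (ℕ.+-suc k j))) ⟩
    (N ℕ.∸ suc k , applyUpTo Q′ (suc k) ++ r ∷ r ∷ [])
      ≡⟨ cong (N ℕ.∸ suc k ,_) (begin
           applyUpTo Q′ (suc k) ++ r ∷ r ∷ []    ≡⟨ ∷ʳ-++ (applyUpTo Q′ (suc k)) r (r ∷ []) ⟨
           applyUpTo Q′ (suc k) ∷ʳ r ∷ʳ r        ≡⟨ cong₂ (λ a b → applyUpTo Q′ (suc k) ∷ʳ a ∷ʳ b) (sym last₁) (sym last₂) ⟩
           applyUpTo Q′ (suc k) ∷ʳ Q′ (suc k) ∷ʳ Q′ (suc (suc k))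
             ≡⟨ cong (_∷ʳ Q′ (suc (suc k))) (applyUpTo-∷ʳ Q′ (suc k)) ⟩
           applyUpTo Q′ (suc (suc k)) ∷ʳ Q′ (suc (suc k)) ≡⟨ applyUpTo-∷ʳ Q′ (suc (suc k)) ⟩
           applyUpTo Q′ (suc (suc (suc k))) ∎) ⟩
    (N ℕ.∸ suc k , applyUpTo Q′ (2 ℕ.+ suc k)) ∎
    where
    open ≡-Reasoning
    r  = status x N ζ (suc k)
    Q′ = frontier ζ (suc k)
    double : ∀ k → suc k ℕ.+ suc k ≡ 0 ℕ.+ suc k ℕ.* 2
    double k = trans (cong (suc k ℕ.+_) (sym (ℕ.+-identityʳ (suc k)))) (ℕ.*-comm 2 (suc k))
    last₁ : Q′ (suc k) ≡ r
    last₁ = cong (status x N ζ) (trans (cong (ℕ._/ 2) (double k)) ([r+q*n]/n≡q 2 (suc k) {0} z<s))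
    last₂ : Q′ (suc (suc k)) ≡ r
    last₂ = cong (status x N ζ) (trans (cong (ℕ._/ 2) (trans (ℕ.+-suc (suc k) (suc k)) (cong suc (double k))))
      ([r+q*n]/n≡q 2 (suc k) {1} (s≤s z<s)))
    popped : read ζ (N ℕ.∸ k , frontier ζ k 0 ∷ applyUpTo (λ j → frontier ζ k (suc j)) (suc k)) (x k) ≡
      (N ℕ.∸ suc k , applyUpTo (λ j → frontier ζ k (suc j)) (suc k) ++ r ∷ r ∷ [])
    popped with N ℕ.∸ k in eq
    ... | suc n rewrite status-suc x N ζ k
          | ℕ.m≤n⇒m∸n≡0 (ℕ.m∸n≢0⇒n<m {N} {k} (λ e → ℕ.0≢1+n (trans (sym e) eq)))
          | sym (ℕ.pred[m∸n]≡m∸[1+n] N k) | eq = refl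
    ... | zero rewrite status-suc x N ζ k | ℕ.+-identityʳ k | sym (ℕ.pred[m∸n]≡m∸[1+n] N k) | eq
        with suc k ℕ.∸ N | ℕ.m<n⇒0<n∸m (s≤s (ℕ.m∸n≡0⇒m≤n {N} {k} eq))
    ...   | suc _ | _ = refl

  survivors : ℕ → Str 2 → ℕ
  survivors k ζ = ∑< (2 ℕ.+ k) (λ j → encode (frontier ζ k j))

  Dead : ℕ → Str 2 → Set
  Dead k ζ = ∀ j → j ℕ.< 2 ℕ.+ k → frontier ζ k j ≡ dead

  survivors≡0 : ∀ k ζ → survivors k ζ ≡ 0 → Dead k ζ
  survivors≡0 k ζ eq j j< = encode≡0 _ (∑<≡0 (2 ℕ.+ k) eq j j<)

  status-reset : ∀ ζ v → v ℕ.≤ N → status x N ζ v ≡ fresh ζ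
  status-reset ζ zero    _   = refl
  status-reset ζ (suc v) v<N rewrite status-suc x N ζ v | ℕ.m≤n⇒m∸n≡0 v<N = refl

  dead⇒pot≡1 : ∀ k ζ → Dead k ζ → pot ζ (run ζ N (x ↾ k)) ≡ 1ℚ
  dead⇒pot≡1 k ζ D rewrite run-↾ ζ k with N ℕ.∸ k in eq
  ... | zero = all-dead (2 ℕ.+ k) (frontier ζ k) D
    where
    all-dead : ∀ n f → (∀ j → j ℕ.< n → f j ≡ dead) → ∏π (applyUpTo f n) ≡ 1ℚ
    all-dead zero    f _  = refl
    all-dead (suc n) f ds rewrite ds 0 z<s =
      trans (*-identityˡ _) (all-dead n (λ j → f (suc j)) (λ j j<n → ds (suc j) (s≤s j<n)))
  -- While labels are still being ignored, the status at the front of the queue is `fresh ζ`, so not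
  -- everything is dead.
  ... | suc n with () ← trans (sym (D 0 z<s)) (status-reset ζ ((k ℕ.+ 0) ℕ./ 2)
        (ℕ.≤-trans (m/n≤m _ 2) (ℕ.≤-trans (ℕ.≤-reflexive (ℕ.+-identityʳ k))
          (ℕ.<⇒≤ (ℕ.m∸n≢0⇒n<m {N} {k} (λ e → ℕ.0≢1+n (trans (sym e) eq)))))))

  status-extends : ∀ ζ η v → v ℕ.≤ length ζ → Extends η v (length ζ) (status x N ζ v) (status x N (ζ ++ η) v)
  status-extends ζ η = branch-induction _ (λ _ → both-fresh (ℕ.m≤m+n _ 0)) step
    where
    step : ∀ v → (v ℕ./ 2 ℕ.≤ length ζ → Extends η (v ℕ./ 2) (length ζ) (status x N ζ (v ℕ./ 2)) (status x N (ζ ++ η) (v ℕ./ 2))) →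
      suc v ℕ.≤ length ζ → Extends η (suc v) (length ζ) (status x N ζ (suc v)) (status x N (ζ ++ η) (suc v))
    step v rec v<l rewrite status-suc x N ζ v | status-suc x N (ζ ++ η) v with suc v ℕ.∸ N
    ... | zero  = both-fresh (ℕ.m≤m+n _ _)
    ... | suc _ = advance-extends (x v) v<l
      (extends-≤ (m/n≤m v 2) (rec (ℕ.≤-trans (m/n≤m v 2) (ℕ.<⇒≤ v<l))))

  dead-extends : ∀ ζ η v → v ℕ.≤ length ζ → status x N ζ v ≡ dead → status x N (ζ ++ η) v ≡ dead
  dead-extends ζ η v v≤ eq with status x N ζ v | status x N (ζ ++ η) v | status-extends ζ η v v≤
  dead-extends ζ η v v≤ refl | .dead | .dead | both-dead = refl

frontier-node-≤ : ∀ k j → j ℕ.< 2 ℕ.+ k → (k ℕ.+ j) ℕ./ 2 ℕ.≤ k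
frontier-node-≤ k j j< = s≤s⁻¹ (m<n*o⇒m/o<n {k ℕ.+ j} {suc k} {2} (begin-strict
  k ℕ.+ j            ≤⟨ ℕ.+-monoʳ-≤ k (s≤s⁻¹ j<) ⟩
  k ℕ.+ suc k        <⟨ ℕ.n<1+n _ ⟩
  suc k ℕ.+ suc k    ≡⟨ cong (suc k ℕ.+_) (ℕ.+-identityʳ (suc k)) ⟨
  2 ℕ.* suc k        ≡⟨ ℕ.*-comm 2 (suc k) ⟩
  suc k ℕ.* 2        ∎))
  where open ℕ.≤-Reasoning

module _ (x : Seq 3) (i : ℕ) where

  private N = threshold i

  -- An extinct target remains extinct however it is prolonged, and then its potential is 1. The
  -- surplus e lets triggering strings of different lengths be compared with one and the same
  -- supermartingale.
  check⇒½≤extinction : ∀ L e → check i (index (x ↾ L)) ≡ 0 → ½ ≤ extinction N (L ℕ.+ e) (x ↾ L)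
  check⇒½≤extinction L e eq = ≤-trans
    (2^d≤2∑⇒½≤avg L (λ ζ → 1 ℕ.∸ survivors x N L ζ) (ℕ.m∸n≡0⇒m≤n (trans (sym (check-index x L i)) eq)))
    (avg-extend L e extinct)
    where
    extinct : ∀ ζ η → length ζ ≡ L → fromℕ (1 ℕ.∸ survivors x N L ζ) ≤ pot (ζ ++ η) (run (ζ ++ η) N (x ↾ L))
    extinct ζ η refl with survivors x N L ζ in eq
    ... | zero  = ≤-reflexive (sym (dead⇒pot≡1 x N L (ζ ++ η) λ j j< →
      dead-extends x N ζ η _ (frontier-node-≤ L j j<) (survivors≡0 x N L ζ eq j j<)))
    ... | suc n = ≤-trans (≤-reflexive (cong fromℕ (ℕ.0∸n≡0 n))) (0≤pot (ζ ++ η) (run (ζ ++ η) N (x ↾ L)))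

⅞⁶≤½ : ⅞ * (⅞ * (⅞ * (⅞ * (⅞ * ⅞)))) ≤ ½
⅞⁶≤½ = ≤ᵇ⇒≤ _

⅞^[n*6]≤½^n : ∀ n → ⅞ ^ (n ℕ.* 6) ≤ ½ ^ n
⅞^[n*6]≤½^n zero    = ≤-refl
⅞^[n*6]≤½^n (suc n) = begin
  ⅞ * (⅞ * (⅞ * (⅞ * (⅞ * (⅞ * p)))))
    ≡⟨ solve 2 (λ a p → a :* (a :* (a :* (a :* (a :* (a :* p))))) := (a :* (a :* (a :* (a :* (a :* a))))) :* p) refl ⅞ p ⟩
  ⅞ * (⅞ * (⅞ * (⅞ * (⅞ * ⅞)))) * p
    ≤⟨ *-monoʳ-≤-nonNeg p {{nonNegative (0≤^ (n ℕ.* 6) (nonNegative⁻¹ ⅞))}} ⅞⁶≤½ ⟩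
  ½ * p
    ≤⟨ *-monoˡ-≤-nonNeg ½ (⅞^[n*6]≤½^n n) ⟩
  ½ * ½ ^ n ∎
  where
  open ≤-Reasoning
  open +-*-Solver
  p = ⅞ ^ (n ℕ.* 6)

-- The Martin-Löf test

checkᶜ : Code 3
checkᶜ = comp (proj₁ check-computable) (proj (suc zero) ∷ proj (suc (suc zero)) ∷ [])

checkᶜ-⇓ : ∀ y i s → checkᶜ [ y ∷ i ∷ s ∷ [] ]⇓ check i s
checkᶜ-⇓ y i s = ⇓comp (⇓proj ∷ ⇓proj ∷ []) (proj₂ check-computable (i ∷ s ∷ []))

-- `checkᶜ` ignores the variable that is searched over, so the search stops at 0 if `check` is 0 and
-- never otherwise: a decidable condition becomes a halting condition.
test : Code 2
test = min checkᶜ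

test-sound : ∀ {i s v} → test [ i ∷ s ∷ [] ]⇓ v → check i s ≡ 0
test-sound {i} {s} (⇓min p _) = ⇓-deterministic (checkᶜ-⇓ _ i s) p

test-complete : ∀ {i s} → check i s ≡ 0 → test [ i ∷ s ∷ [] ]⇓ 0
test-complete {i} {s} eq = ⇓min (subst (checkᶜ [ 0 ∷ i ∷ s ∷ [] ]⇓_) eq (checkᶜ-⇓ 0 i s)) (λ _ ())

Triggers : ℕ → Str 3 → Set
Triggers i σ = check i (index σ) ≡ 0

cons : ∀ {k} → Fin k → Seq k → Seq k
cons a x zero    = a
cons a x (suc n) = x n

-- Transfers facts about `index` from initial segments of sequences, where they are proved, to
-- arbitrary strings.
prolongation : ∀ {k} .{{_ : ℕ.NonZero k}} (σ : Str k) → ∃ λ x → σ ≡ x ↾ length σ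
prolongation {suc k} []      = (λ _ → zero) , refl
prolongation         (a ∷ σ) with x , eq ← prolongation σ = cons a x , cong (a ∷_) eq

module _ {k} .{{_ : ℕ.NonZero k}} where

  ↾-index-injective : ∀ (x y : Seq k) m n → index (x ↾ m) ≡ index (y ↾ n) → x ↾ m ≡ y ↾ n
  ↾-index-injective x y zero    zero    eq = refl
  ↾-index-injective x y zero    (suc n) eq = ⊥-elim (ℕ.0≢1+n (trans eq (index-↾-suc y n)))
  ↾-index-injective x y (suc m) zero    eq = ⊥-elim (ℕ.0≢1+n (trans (sym eq) (index-↾-suc x m)))
  ↾-index-injective x y (suc m) (suc n) eq = begin
    x ↾ suc m        ≡⟨ applyUpTo-∷ʳ x m ⟨
    x ↾ m ∷ʳ x m     ≡⟨ cong₂ _∷ʳ_ (↾-index-injective x y m n init) (Fin.toℕ-injective final) ⟩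
    y ↾ n ∷ʳ y n     ≡⟨ applyUpTo-∷ʳ y n ⟩
    y ↾ suc n        ∎
    where
    open ≡-Reasoning
    init = trans (sym (pred-index-/ x m)) (trans (cong (λ s → pred s ℕ./ k) eq) (pred-index-/ y n))
    final = trans (sym (pred-index-% x m)) (trans (cong (λ s → pred s ℕ.% k) eq) (pred-index-% y n))

  index-injective : ∀ (σ τ : Str k) → index σ ≡ index τ → σ ≡ τ
  index-injective σ τ eq with x , p ← prolongation σ | y , q ← prolongation τ =
    trans p (trans (↾-index-injective x y _ _ (trans (cong index (sym p)) (trans eq (cong index q)))) (sym q))

  length≤index : ∀ (σ : Str k) → length σ ℕ.≤ index σ
  length≤index σ with x , p ← prolongation σ =
    subst (λ τ → length σ ℕ.≤ index τ) (sym p) (n≤index-↾ x (length σ))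

⊑-↾ : ∀ {k} (x : Seq k) n {σ} → σ ⊑ x ↾ n → σ ≡ x ↾ length σ
⊑-↾ x n       {[]}    _        = refl
⊑-↾ x (suc n) {a ∷ σ} (ρ , eq) with refl , eq′ ← ∷-injective eq =
  cong (x 0 ∷_) (⊑-↾ (λ i → x (suc i)) n (ρ , eq′))

least : ∀ {P : ℕ → Set} → (∀ n → Dec (P n)) → ∀ n → P n → ∃ λ m → P m × (∀ l → P l → m ℕ.≤ l)
least P? n p with P? 0
... | yes p₀ = 0 , p₀ , λ _ _ → z≤n
least P? zero    p | no ¬p₀ = ⊥-elim (¬p₀ p)
least {P} P? (suc n) p | no ¬p₀ with m , q , low ← least (λ m → P? (suc m)) n p =
  suc m , q , λ { zero r → ⊥-elim (¬p₀ r) ; (suc l) r → s≤s (low l r) }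

module _ (em : ExcludedMiddle 0ℓ) (i : ℕ) where

  Minimal : Str 3 → Set
  Minimal σ = Triggers i σ × (∀ τ ρ → τ ++ ρ ≡ σ → Triggers i τ → ρ ≡ [])

  -- Triggering strings may extend one another, and their total weight may be too large. The minimal
  -- ones cover the same open set and form an antichain, as Kolmogorov's inequality requires.
  minimals : Family 3
  minimals n with em {∃ λ σ → index σ ≡ n × Minimal σ}
  ... | yes (σ , _) = just σ
  ... | no  _       = nothing

  minimals-just : ∀ n σ → minimals n ≡ just σ → index σ ≡ n × Minimal σ
  minimals-just n σ eq with em {∃ λ σ → index σ ≡ n × Minimal σ}
  minimals-just n σ refl | yes (_ , p) = p

  minimals-index : ∀ σ → Minimal σ → minimals (index σ) ≡ just σ
  minimals-index σ low with em {∃ λ τ → index τ ≡ index σ × Minimal τ}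
  ... | yes (τ , eq , _) = cong just (index-injective τ σ eq)
  ... | no  none = ⊥-elim (none (σ , refl , low))

  minimals-cover : Σ₁Open test i ⊆ ⋃ minimals
  minimals-cover {x} (σ , v , halts , x∈σ)
    with L , pos , low ← least (λ n → check i (index (x ↾ n)) ℕ.≟ 0) (length σ)
           (subst (Triggers i) (sym x∈σ) (test-sound halts)) =
    index (x ↾ L) , x ↾ L , minimals-index (x ↾ L) (pos , shortest) , cong (x ↾_) (length-applyUpTo x L)
    where
    shortest : ∀ τ ρ → τ ++ ρ ≡ x ↾ L → Triggers i τ → ρ ≡ []
    shortest τ []      eq p = refl
    shortest τ (a ∷ ρ) eq p = ⊥-elim (ℕ.<⇒≱ shorter (low (length τ) (subst (Triggers i) (⊑-↾ x L {τ} (a ∷ ρ , eq)) p)))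
      where
      shorter : length τ ℕ.< L
      shorter = begin-strict
        length τ                       <⟨ ℕ.m<m+n (length τ) z<s ⟩
        length τ ℕ.+ length (a ∷ ρ)    ≡⟨ length-++ τ ⟨
        length (τ ++ a ∷ ρ)            ≡⟨ cong length eq ⟩
        length (x ↾ L)                 ≡⟨ length-applyUpTo x L ⟩
        L                              ∎
        where open ℕ.≤-Reasoning

  minimals-incomparable : ∀ {m n} → m ≢ n → Incomparable (minimals m) (minimals n)
  minimals-incomparable {m} {n} m≢n σ eq τ eq′
    with p , pos , low ← minimals-just m σ eq | q , pos′ , low′ ← minimals-just n τ eq′ =
    (λ (ρ , e) → m≢n (trans (sym p) (trans (cong index (same ρ e (low′ σ ρ e pos))) q))) ,
    (λ (ρ , e) → m≢n (trans (sym p) (trans (cong index (sym (same ρ e (low τ ρ e pos′)))) q)))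
    where
    same : ∀ {σ τ : Str 3} ρ → σ ++ ρ ≡ τ → ρ ≡ [] → σ ≡ τ
    same {σ} .[] e refl = trans (sym (++-identityʳ σ)) e

  -- The first n places contain only strings with number, hence length, below n. So the
  -- supermartingale for targets of length n is at least ½ on all of them; the factor 2 lost to θ =
  -- ½ is covered by the exponent `suc i`.
  minimals-total : ∀ n → partialSum minimals n ≤ ½ ^ i
  minimals-total n = *-cancelˡ-≤-pos ½ (begin
    ½ * total (applyUpTo minimals n)
      ≤⟨ kolmogorov-inequality n (applyUpTo minimals n) ½ (extinction-supermartingale N n) (0≤extinction N n)
           (AllPairs.applyUpTo⁺₁ minimals n (λ i<j _ → minimals-incomparable (ℕ.<⇒≢ i<j)))
           (All.applyUpTo⁺₁ minimals n large) ⟩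
    extinction N n []      ≡⟨ extinction-[] N n ⟩
    ⅞ ^ (suc i ℕ.* 6)      ≤⟨ ⅞^[n*6]≤½^n (suc i) ⟩
    ½ * ½ ^ i              ∎)
    where
    open ≤-Reasoning
    N = threshold i
    large : ∀ {m} → m ℕ.< n → OnJust (λ σ → length σ ℕ.< n × ½ ≤ extinction N n σ) (minimals m)
    large {m} m<n σ eq with p , pos , _ ← minimals-just m σ eq | x , q ← prolongation σ =
      shorter , subst₂ (λ d τ → ½ ≤ extinction N d τ) (ℕ.m+[n∸m]≡n (ℕ.<⇒≤ shorter)) (sym q)
        (check⇒½≤extinction x i (length σ) (n ℕ.∸ length σ) (subst (Triggers i) q pos))
      where
      shorter : length σ ℕ.< n
      shorter = ℕ.≤-<-trans (ℕ.≤-trans (length≤index σ) (ℕ.≤-reflexive p)) m<n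

  test-measure : Measure≤ {3} (Σ₁Open test i) (½ ^ i)
  test-measure ε 0<ε = minimals , minimals-cover , λ n →
    ≤-trans (minimals-total n) (subst (_≤ ½ ^ i + ε) (+-identityʳ (½ ^ i)) (+-monoʳ-≤ (½ ^ i) (<⇒≤ 0<ε)))

random-passes : ExcludedMiddle 0ℓ → ∀ x → MLRandom {3} x → ∃ λ i → ∀ L → check i (index (x ↾ L)) ≢ 0
random-passes em x random with em {∃ λ i → ∀ L → check i (index (x ↾ L)) ≢ 0}
... | yes passes = passes
... | no  fails  = ⊥-elim (random test (test-measure em) captured)
  where
  captured : ∀ i → x ∈ Σ₁Open test i
  captured i with em {∃ λ L → check i (index (x ↾ L)) ≡ 0}
  ... | yes (L , eq) = x ↾ L , 0 , test-complete eq , cong (x ↾_) (length-applyUpTo x L)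
  ... | no  none     = ⊥-elim (fails (i , λ L eq → none (L , eq)))

-- Deleting the 2's

Recurrent : Seq 3 → Set
Recurrent s = ∀ m → ∃ λ j → m ℕ.≤ j × s j ≢ v2

-- The position `j` of some letter other than 2 bounds the search for the first such letter.
first-bit : ∀ j s → s j ≢ v2 → ∃ λ i → ∃ λ b → ∀ m →
  mapMaybe bit? (s ↾ (suc i ℕ.+ m)) ≡ b ∷ mapMaybe bit? ((λ l → s (suc i ℕ.+ l)) ↾ m)
first-bit j s sj≢2 with s 0 in eq
... | zero     = 0 , zero , λ m → refl
... | suc zero = 0 , suc zero , λ m → refl
first-bit zero    s sj≢2 | v2 = ⊥-elim (sj≢2 eq)
first-bit (suc j) s sj≢2 | v2 with i , b , p ← first-bit j (λ l → s (suc l)) sj≢2 =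
  suc i , b , p

recurrent-drop : ∀ i {s} → Recurrent s → Recurrent (λ l → s (i ℕ.+ l))
recurrent-drop i {s} rec m with j , le , p ← rec (i ℕ.+ m) =
  j ℕ.∸ i , ℕ.m+n≤o⇒m≤o∸n m (subst (ℕ._≤ j) (ℕ.+-comm i m) le) ,
  λ eq → p (trans (cong s (sym (ℕ.m+[n∸m]≡n (ℕ.m+n≤o⇒m≤o i le)))) eq)

deleted : ∀ s → Recurrent s → Seq 2
deleted s rec n with _ , _ , p ← rec 0 with first-bit _ s p
deleted s rec zero    | i , b , _ = b
deleted s rec (suc n) | i , b , _ = deleted (λ l → s (suc i ℕ.+ l)) (recurrent-drop (suc i) rec) n

deletes-2s : ∀ s (rec : Recurrent s) → Deletes2sTo s (deleted s rec)
deletes-2s s rec zero    = 0 , refl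
deletes-2s s rec (suc n) with _ , _ , p ← rec 0 with first-bit _ s p
... | i , b , q with m , eq ← deletes-2s (λ l → s (suc i ℕ.+ l)) (recurrent-drop (suc i) rec) n =
  suc i ℕ.+ m , trans (q m) (cong (b ∷_) eq)

-- König's lemma

index-< : ∀ (x : Seq 2) n → 2 ℕ.+ index (x ↾ n) ℕ.≤ 2 ℕ.^ suc n
index-< x zero    = ℕ.≤-refl
index-< x (suc n) rewrite index-↾-suc x n = begin
  3 ℕ.+ (toℕ (x n) ℕ.+ index (x ↾ n) ℕ.* 2)  ≤⟨ ℕ.+-monoʳ-≤ 3 (ℕ.+-monoˡ-≤ _ (s≤s⁻¹ (Fin.toℕ<n (x n)))) ⟩
  (2 ℕ.+ index (x ↾ n)) ℕ.* 2                ≤⟨ ℕ.*-monoˡ-≤ 2 (index-< x n) ⟩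
  2 ℕ.^ suc n ℕ.* 2                          ≡⟨ ℕ.*-comm (2 ℕ.^ suc n) 2 ⟩
  2 ℕ.^ suc (suc n)                          ∎
  where open ℕ.≤-Reasoning

module König (em : ExcludedMiddle 0ℓ) (T : ℕ → Set)
  (parent : ∀ (x : Seq 2) n → T (index (x ↾ suc n)) → T (index (x ↾ n))) where

  prefix-closed : ∀ (τ ρ : Str 2) → T (index (τ ++ ρ)) → T (index τ)
  prefix-closed τ ρ t with x , eq ← prolongation (τ ++ ρ) =
    subst (λ σ → T (index σ)) (sym (⊑-↾ x _ (ρ , eq)))
      (go (length ρ) (subst (λ σ → T (index σ)) (trans eq (cong (x ↾_) (trans (length-++ τ) (ℕ.+-comm (length τ) _)))) t))
    where
    go : ∀ n → T (index (x ↾ (n ℕ.+ length τ))) → T (index (x ↾ length τ))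
    go zero    t = t
    go (suc n) t = go n (parent x (n ℕ.+ length τ) t)

  Unbounded : Str 2 → Set
  Unbounded τ = ∀ n → ∃ λ ρ → n ℕ.≤ length ρ × T (index (τ ++ ρ))

  bounded : ∀ τ → ¬ Unbounded τ → ∃ λ n → ∀ ρ → n ℕ.≤ length ρ → ¬ T (index (τ ++ ρ))
  bounded τ ¬u with em {∃ λ n → ∀ ρ → n ℕ.≤ length ρ → ¬ T (index (τ ++ ρ))}
  ... | yes b = b
  ... | no ¬b = ⊥-elim (¬u u)
    where
    u : Unbounded τ
    u n with em {∃ λ ρ → n ℕ.≤ length ρ × T (index (τ ++ ρ))}
    ... | yes w = w
    ... | no ¬w = ⊥-elim (¬b (n , λ ρ le t → ¬w (ρ , le , t)))

  child : ∀ τ → Unbounded τ → ∃ λ a → Unbounded (τ ∷ʳ a)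
  child τ u with em {Unbounded (τ ∷ʳ zero)} | em {Unbounded (τ ∷ʳ suc zero)}
  ... | yes u₀ | _      = zero , u₀
  ... | no _   | yes u₁ = suc zero , u₁
  ... | no ¬u₀ | no ¬u₁ with m , p ← bounded (τ ∷ʳ zero) ¬u₀ | n , q ← bounded (τ ∷ʳ suc zero) ¬u₁ | u (suc (m ℕ.+ n))
  ...   | zero ∷ ρ , s≤s le , t =
    ⊥-elim (p ρ (ℕ.m+n≤o⇒m≤o m le) (subst (λ σ → T (index σ)) (sym (∷ʳ-++ τ zero ρ)) t))
  ...   | suc zero ∷ ρ , s≤s le , t =
    ⊥-elim (q ρ (ℕ.m+n≤o⇒n≤o m le) (subst (λ σ → T (index σ)) (sym (∷ʳ-++ τ (suc zero) ρ)) t))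

  module _ (u : Unbounded []) where

    grow : ℕ → ∃ Unbounded
    next-bit : ∀ n → ∃ λ a → Unbounded (proj₁ (grow n) ∷ʳ a)
    grow zero    = [] , u
    grow (suc n) = proj₁ (grow n) ∷ʳ proj₁ (next-bit n) , proj₂ (next-bit n)
    next-bit n = child (proj₁ (grow n)) (proj₂ (grow n))

    path : Seq 2
    path n = proj₁ (next-bit n)

    path-↾ : ∀ n → path ↾ n ≡ proj₁ (grow n)
    path-↾ zero    = refl
    path-↾ (suc n) = trans (sym (applyUpTo-∷ʳ path n)) (cong (_∷ʳ path n) (path-↾ n))

    path-T : ∀ n → T (index (path ↾ n))
    path-T n with ρ , _ , t ← proj₂ (grow n) 0 =
      subst (λ σ → T (index σ)) (sym (path-↾ n)) (prefix-closed (proj₁ (grow n)) ρ t)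

  -- Without a path the lengths in `T` are bounded. The bound is restated for node numbers, in which
  -- the frontier is described: a string shorter than B has a number below 2^(B + 1).
  finite : (∀ (y : Seq 2) → ¬ (∀ n → T (index (y ↾ n)))) → ∃ λ B → ∀ v → B ℕ.≤ v → ¬ T v
  finite no-path with B , p ← bounded [] (λ u → no-path (path u) (path-T u)) =
    2 ℕ.^ suc B , λ v le t → p (enum v) (long v le) (subst T (sym (index-enum v)) t)
    where
    long : ∀ v → 2 ℕ.^ suc B ℕ.≤ v → B ℕ.≤ length (enum v)
    long v le with B ℕ.≤? length (enum v)
    ... | yes B≤ = B≤
    ... | no  B≰ with x , eq ← prolongation (enum v) = ⊥-elim (ℕ.<⇒≱ {v} (begin
      1 ℕ.+ v                                     ≡⟨ cong suc (trans (sym (index-enum v)) (cong index eq)) ⟩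
      1 ℕ.+ index (x ↾ length (enum v))           ≤⟨ ℕ.n≤1+n _ ⟩
      2 ℕ.+ index (x ↾ length (enum v))           ≤⟨ index-< x (length (enum v)) ⟩
      2 ℕ.^ suc (length (enum v))                 ≤⟨ ℕ.^-monoʳ-≤ 2 (s≤s (ℕ.<⇒≤ (ℕ.≰⇒> B≰))) ⟩
      2 ℕ.^ suc B                                 ∎) le)
      where open ℕ.≤-Reasoning

-- The output along the branch to a node

index-↾-pred : ∀ {k} (x : Seq k) n → index (x ↾ suc n) ≡ suc (pred (index (x ↾ suc n)))
index-↾-pred x n = trans (index-↾-suc x n) (cong (λ m → suc (pred m)) (sym (index-↾-suc x n)))

module _ (x : Seq 3) where

  outputStep : Str 2 → ℕ → Str 2
  outputStep o v = o ++ mapMaybe bit? (x (pred v) ∷ [])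

  output : ℕ → Str 2
  output = branchFold [] outputStep

  output-suc : ∀ v → output (suc v) ≡ output (v ℕ./ 2) ++ mapMaybe bit? (x v ∷ [])
  output-suc = branchFold-suc [] outputStep

  labels : Seq 2 → Seq 3
  labels y n = label x (y ↾ suc n)

  output-↾ : ∀ y n → output (index (y ↾ n)) ≡ mapMaybe bit? (labels y ↾ n)
  output-↾ y zero    = refl
  output-↾ y (suc n) = begin
    output (index (y ↾ suc n))                                       ≡⟨ cong output (index-↾-pred y n) ⟩
    output (suc (pred (index (y ↾ suc n))))                          ≡⟨ output-suc (pred (index (y ↾ suc n))) ⟩
    output (pred (index (y ↾ suc n)) ℕ./ 2) ++ last                  ≡⟨ cong (λ v → output v ++ last) (pred-index-/ y n) ⟩
    output (index (y ↾ n)) ++ last                                   ≡⟨ cong (_++ last) (output-↾ y n) ⟩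
    mapMaybe bit? (labels y ↾ n) ++ last                             ≡⟨ mapMaybe-++ bit? (labels y ↾ n) (labels y n ∷ []) ⟨
    mapMaybe bit? (labels y ↾ n ∷ʳ labels y n)                       ≡⟨ cong (mapMaybe bit?) (applyUpTo-∷ʳ (labels y) n) ⟩
    mapMaybe bit? (labels y ↾ suc n)                                 ∎
    where
    open ≡-Reasoning
    last = mapMaybe bit? (labels y n ∷ [])

remaining : Status → Maybe (Str 2)
remaining dead       = nothing
remaining (fresh ρ)  = just ρ
remaining (paused ρ) = just ρ

Emitted : Fin 3 → Str 2 → Str 2 → Set
Emitted a ρ ρ′ = ρ ≡ [] ⊎ ρ ≡ mapMaybe bit? (a ∷ []) ++ ρ′

advance-remaining : ∀ q a {ρ′} → remaining (advance q a) ≡ just ρ′ →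
  ∃ λ ρ → remaining q ≡ just ρ × Emitted a ρ ρ′
advance-remaining (fresh [])                zero       eq   = [] , refl , inj₁ refl
advance-remaining (fresh [])                (suc zero) eq   = [] , refl , inj₁ refl
advance-remaining (fresh (zero ∷ ρ))        zero       refl = zero ∷ ρ , refl , inj₂ refl
advance-remaining (fresh (suc zero ∷ ρ))    (suc zero) refl = suc zero ∷ ρ , refl , inj₂ refl
advance-remaining (fresh ρ)                 v2         refl = ρ , refl , inj₂ refl
advance-remaining (paused [])               zero       eq   = [] , refl , inj₁ refl
advance-remaining (paused [])               (suc zero) eq   = [] , refl , inj₁ refl
advance-remaining (paused (zero ∷ ρ))       zero       refl = zero ∷ ρ , refl , inj₂ refl
advance-remaining (paused (suc zero ∷ ρ))   (suc zero) refl = suc zero ∷ ρ , refl , inj₂ refl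
advance-remaining (paused ρ)                v2         ()

alive-remaining : ∀ q → q ≢ dead → ∃ λ ρ → remaining q ≡ just ρ
alive-remaining dead       alive = ⊥-elim (alive refl)
alive-remaining (fresh ρ)  alive = ρ , refl
alive-remaining (paused ρ) alive = ρ , refl

bit-length : ∀ a → length (mapMaybe bit? (a ∷ [])) ℕ.≤ 1
bit-length zero       = ℕ.≤-refl
bit-length (suc zero) = ℕ.≤-refl
bit-length v2         = z≤n

module _ (x : Seq 3) (N : ℕ) (ζ : Str 2) where

  -- Here `word` is the output produced below the reset node `root`, and the target starts with it.
  -- So the output at v followed by `ρ` equals the output at `root` followed by ζ, and a cylinder
  -- string that is a prefix of the former is a prefix of the latter.
  record Factored (v : ℕ) (ρ : Str 2) : Set where
    constructor factored
    field
      {root}     : ℕ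
      {word}     : Str 2
      root≤N     : root ℕ.≤ N
      output≡    : output x v ≡ output x root ++ word
      target≡    : ζ ≡ word ++ ρ
      unconsumed : length ζ ℕ.≤ length ρ ℕ.+ v

  status-factored : ∀ v → v ℕ.≤ length ζ → ∀ ρ → remaining (status x N ζ v) ≡ just ρ → Factored v ρ
  status-factored = branch-induction _ (λ _ ρ eq → atRoot eq) step
    where
    atRoot : ∀ {ρ} → just ζ ≡ just ρ → Factored 0 ρ
    atRoot refl = factored z≤n (sym (++-identityʳ _)) refl (ℕ.m≤m+n _ 0)

    step : ∀ v → (v ℕ./ 2 ℕ.≤ length ζ → ∀ ρ → remaining (status x N ζ (v ℕ./ 2)) ≡ just ρ → Factored (v ℕ./ 2) ρ) →
      suc v ℕ.≤ length ζ → ∀ ρ → remaining (status x N ζ (suc v)) ≡ just ρ → Factored (suc v) ρ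
    step v rec v<l ρ′ eq rewrite status-suc x N ζ v with suc v ℕ.∸ N in over
    step v rec v<l ρ′ refl | zero =
      factored (ℕ.m∸n≡0⇒m≤n over) (sym (++-identityʳ _)) refl (ℕ.m≤m+n _ _)
    step v rec v<l ρ′ eq | suc _ with ρ , eq′ , emitted ← advance-remaining (status x N ζ (v ℕ./ 2)) (x v) eq
      with factored {r} {o} r≤N out≡ ζ≡ un ← rec (ℕ.≤-trans (m/n≤m v 2) (ℕ.<⇒≤ v<l)) ρ eq′ | emitted
    -- An exhausted target would have length at most v / 2, but it is longer than v.
    ... | inj₁ refl = ⊥-elim (ℕ.<⇒≱ v<l (ℕ.≤-trans un (m/n≤m v 2)))
    ... | inj₂ refl = factored r≤N
      (trans (output-suc x v) (trans (cong (_++ b) out≡) (++-assoc (output x r) o b)))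
      (trans ζ≡ (sym (++-assoc o b ρ′)))
      (begin
        length ζ                                  ≤⟨ un ⟩
        length (b ++ ρ′) ℕ.+ v ℕ./ 2              ≡⟨ cong (ℕ._+ v ℕ./ 2) (length-++ b) ⟩
        length b ℕ.+ length ρ′ ℕ.+ v ℕ./ 2        ≤⟨ ℕ.+-mono-≤ (ℕ.+-monoˡ-≤ (length ρ′) (bit-length (x v))) (m/n≤m v 2) ⟩
        1 ℕ.+ length ρ′ ℕ.+ v                     ≡⟨ ℕ.+-suc (length ρ′) v ⟨
        length ρ′ ℕ.+ suc v                       ∎)
      where
      open ℕ.≤-Reasoning
      b = mapMaybe bit? (x v ∷ [])

-- Counting the targets hit by a family of cylinders

hit : Str 2 → Str 2 → ℚ
hit []             ζ              = 1ℚ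
hit (_ ∷ _)        []             = 0ℚ
hit (zero ∷ σ)     (zero ∷ ζ)     = hit σ ζ
hit (suc zero ∷ σ) (suc zero ∷ ζ) = hit σ ζ
hit (zero ∷ σ)     (suc zero ∷ ζ) = 0ℚ
hit (suc zero ∷ σ) (zero ∷ ζ)     = 0ℚ

0≤hit : ∀ σ ζ → 0ℚ ≤ hit σ ζ
0≤hit []             ζ              = nonNegative⁻¹ 1ℚ
0≤hit (_ ∷ _)        []             = ≤-refl
0≤hit (zero ∷ σ)     (zero ∷ ζ)     = 0≤hit σ ζ
0≤hit (suc zero ∷ σ) (suc zero ∷ ζ) = 0≤hit σ ζ
0≤hit (zero ∷ σ)     (suc zero ∷ ζ) = ≤-refl
0≤hit (suc zero ∷ σ) (zero ∷ ζ)     = ≤-refl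

hit-⊑ : ∀ σ ρ → hit σ (σ ++ ρ) ≡ 1ℚ
hit-⊑ []             ρ = refl
hit-⊑ (zero ∷ σ)     ρ = hit-⊑ σ ρ
hit-⊑ (suc zero ∷ σ) ρ = hit-⊑ σ ρ

hit-avg : ∀ d σ → avg d (hit σ) ≤ ½ ^ length σ
hit-avg d       []             = ≤-reflexive (avg-const d 1ℚ)
hit-avg zero    (_ ∷ σ)        = 0≤^ (suc (length σ)) (nonNegative⁻¹ ½)
hit-avg (suc d) (zero ∷ σ)     = *-monoˡ-≤-nonNeg ½ (≤-trans
  (≤-reflexive (trans (cong (avg d (hit σ) +_) (avg-const d 0ℚ)) (+-identityʳ _))) (hit-avg d σ))
hit-avg (suc d) (suc zero ∷ σ) = *-monoˡ-≤-nonNeg ½ (≤-trans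
  (≤-reflexive (trans (cong (_+ avg d (hit σ)) (avg-const d 0ℚ)) (+-identityˡ _))) (hit-avg d σ))

2ℚ : ℚ
2ℚ = 1ℚ + 1ℚ

1≤2^ : ∀ n → 1ℚ ≤ 2ℚ ^ n
1≤2^ zero    = ≤-refl
1≤2^ (suc n) = ≤-trans (≤ᵇ⇒≤ _) (*-monoˡ-≤-nonNeg 2ℚ (1≤2^ n))

-- Prefixing w scales measure by 2^(-length w), so pulling a cylinder back enlarges it at most by
-- the inverse factor. If σ runs out within w, every ζ is hit, and the bound is at least 1.
hit-++-avg : ∀ d w σ → avg d (λ ζ → hit σ (w ++ ζ)) ≤ 2ℚ ^ length w * ½ ^ length σ
hit-++-avg d []      σ       = ≤-trans (hit-avg d σ) (≤-reflexive (sym (*-identityˡ _)))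
hit-++-avg d (b ∷ w) []      = ≤-trans (≤-reflexive (avg-const d 1ℚ))
  (≤-trans (1≤2^ (suc (length w))) (≤-reflexive (sym (*-identityʳ _))))
hit-++-avg d (b ∷ w) (a ∷ σ) = ≤-trans (cases a b)
  (≤-reflexive (solve 2 (λ p q → p :* q := (con 2ℚ :* p) :* (con ½ :* q)) refl (2ℚ ^ length w) (½ ^ length σ)))
  where
  open +-*-Solver
  0≤bound : avg d (λ ζ → 0ℚ) ≤ 2ℚ ^ length w * ½ ^ length σ
  0≤bound = ≤-trans (≤-reflexive (avg-const d 0ℚ))
    (0≤* (0≤^ (length w) (nonNegative⁻¹ 2ℚ)) (0≤^ (length σ) (nonNegative⁻¹ ½)))
  cases : ∀ a b → avg d (λ ζ → hit (a ∷ σ) (b ∷ w ++ ζ)) ≤ 2ℚ ^ length w * ½ ^ length σ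
  cases zero       zero       = hit-++-avg d w σ
  cases (suc zero) (suc zero) = hit-++-avg d w σ
  cases zero       (suc zero) = 0≤bound
  cases (suc zero) zero       = 0≤bound

hitᴹ : Maybe (Str 2) → Str 2 → ℚ
hitᴹ nothing  ζ = 0ℚ
hitᴹ (just σ) ζ = hit σ ζ

0≤hitᴹ : ∀ m ζ → 0ℚ ≤ hitᴹ m ζ
0≤hitᴹ nothing  ζ = ≤-refl
0≤hitᴹ (just σ) ζ = 0≤hit σ ζ

hitᴹ-++-avg : ∀ d w m → avg d (λ ζ → hitᴹ m (w ++ ζ)) ≤ 2ℚ ^ length w * weight m
hitᴹ-++-avg d w nothing  = ≤-reflexive (trans (avg-const d 0ℚ) (sym (*-zeroʳ (2ℚ ^ length w))))
hitᴹ-++-avg d w (just σ) = hit-++-avg d w σ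

module _ {A : Set} where

  ∑-nonNeg : ∀ {g : A → ℚ} → (∀ a → 0ℚ ≤ g a) → ∀ as → 0ℚ ≤ ∑ g as
  ∑-nonNeg 0≤g []       = ≤-refl
  ∑-nonNeg 0≤g (a ∷ as) = +-mono-≤ (0≤g a) (∑-nonNeg 0≤g as)

  ∑-term : ∀ {g : A → ℚ} → (∀ a → 0ℚ ≤ g a) → ∀ f n k → k ℕ.< n → g (f k) ≤ ∑ g (applyUpTo f n)
  ∑-term {g} 0≤g f (suc n) zero    _         = ≤-trans (≤-reflexive (sym (+-identityʳ (g (f 0)))))
    (+-monoʳ-≤ (g (f 0)) (∑-nonNeg 0≤g (applyUpTo (λ i → f (suc i)) n)))
  ∑-term {g} 0≤g f (suc n) (suc k) (s≤s k<n) = ≤-trans (∑-term 0≤g (λ i → f (suc i)) n k k<n)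
    (≤-trans (≤-reflexive (sym (+-identityˡ _))) (+-monoˡ-≤ _ (0≤g (f 0))))

  ∑-*ˡ : ∀ r (g : A → ℚ) as → ∑ (λ a → r * g a) as ≡ r * ∑ g as
  ∑-*ˡ r g []       = sym (*-zeroʳ r)
  ∑-*ˡ r g (a ∷ as) = trans (cong (r * g a +_) (∑-*ˡ r g as)) (sym (*-distribˡ-+ r (g a) (∑ g as)))

  ∑-*ʳ : ∀ r (g : A → ℚ) as → ∑ (λ a → g a * r) as ≡ ∑ g as * r
  ∑-*ʳ r g []       = sym (*-zeroˡ r)
  ∑-*ʳ r g (a ∷ as) = trans (cong (g a * r +_) (∑-*ʳ r g as)) (sym (*-distribʳ-+ r (g a) (∑ g as)))

  avg-∑ : ∀ d {g : A → Str 2 → ℚ} {h} → (∀ a → avg d (g a) ≤ h a) → ∀ as →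
    avg d (λ ζ → ∑ (λ a → g a ζ) as) ≤ ∑ h as
  avg-∑ d         g≤h []       = ≤-reflexive (avg-const d 0ℚ)
  avg-∑ d {g} {h} g≤h (a ∷ as) = ≤-trans (≤-reflexive (avg-+ d (g a) (λ ζ → ∑ (λ a → g a ζ) as)))
    (+-mono-≤ (g≤h a) (avg-∑ d g≤h as))

hits : List (Str 2) → List (Maybe (Str 2)) → Str 2 → ℚ
hits ws ms ζ = ∑ (λ w → ∑ (λ m → hitᴹ m (w ++ ζ)) ms) ws

expansion : List (Str 2) → ℚ
expansion = ∑ (λ w → 2ℚ ^ length w)

hits-avg : ∀ d ws ms → avg d (hits ws ms) ≤ expansion ws * ∑ weight ms
hits-avg d ws ms = ≤-trans
  (avg-∑ d (λ w → ≤-trans (avg-∑ d (hitᴹ-++-avg d w) ms) (≤-reflexive (∑-*ˡ (2ℚ ^ length w) weight ms))) ws)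
  (≤-reflexive (∑-*ʳ (∑ weight ms) (λ w → 2ℚ ^ length w) ws))

0≤hits : ∀ ws ms ζ → 0ℚ ≤ hits ws ms ζ
0≤hits ws ms ζ = ∑-nonNeg (λ w → ∑-nonNeg (λ m → 0≤hitᴹ m (w ++ ζ)) ms) ws

1≤hits : ∀ f l c n {v k σ} ζ → v ℕ.< l → k ℕ.< n → c k ≡ just σ → σ ⊑ f v ++ ζ →
  1ℚ ≤ hits (applyUpTo f l) (applyUpTo c n) ζ
1≤hits f l c n {v} {k} {σ} ζ v<l k<n eq (ρ , eq′) = begin
  1ℚ                                              ≡⟨ hit-⊑ σ ρ ⟨
  hit σ (σ ++ ρ)                                  ≡⟨ cong (hit σ) eq′ ⟩
  hit σ (f v ++ ζ)                                ≡⟨ cong (λ m → hitᴹ m (f v ++ ζ)) eq ⟨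
  hitᴹ (c k) (f v ++ ζ)                           ≤⟨ ∑-term (λ m → 0≤hitᴹ m (f v ++ ζ)) c n k k<n ⟩
  ∑ (λ m → hitᴹ m (f v ++ ζ)) (applyUpTo c n)
    ≤⟨ ∑-term (λ w → ∑-nonNeg (λ m → 0≤hitᴹ m (w ++ ζ)) (applyUpTo c n)) f l v v<l ⟩
  hits (applyUpTo f l) (applyUpTo c n) ζ          ∎
  where open ≤-Reasoning

bounded-choice : ∀ {P : ℕ → ℕ → Set} n → (∀ v → ∃ (P v)) → ∃ λ m → ∀ v → v ℕ.< n → ∃ λ k → k ℕ.< m × P v k
bounded-choice zero    choice = 0 , λ _ ()
bounded-choice {P} (suc n) choice with m , below ← bounded-choice {P} n choice | k , p ← choice n =
  suc (k ℕ.+ m) , λ v v<1+n → [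
    (λ v<n → let k′ , k′<m , q = below v v<n in
      k′ , ℕ.<-≤-trans k′<m (ℕ.m≤n⇒m≤1+n (ℕ.m≤n+m m k)) , q) ,
    (λ { refl → k , s≤s (ℕ.m≤m+n k m) , p }) ]′ (ℕ.m≤n⇒m<n∨m≡n (s≤s⁻¹ v<1+n))

∑<≢0 : ∀ n s → ∑< n s ≢ 0 → ∃ λ j → j ℕ.< n × s j ≢ 0
∑<≢0 zero    s ≢0 = ⊥-elim (≢0 refl)
∑<≢0 (suc n) s ≢0 with s n ℕ.≟ 0
... | no  sn≢0 = n , ℕ.≤-refl , sn≢0
... | yes sn≡0 with j , j<n , sj≢0 ← ∑<≢0 n s (λ eq → ≢0 (cong₂ ℕ._+_ eq sn≡0)) =
  j , ℕ.m<n⇒m<1+n j<n , sj≢0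

-- Randomness makes the range large

p≤p+q : ∀ {p q} → 0ℚ ≤ q → p ≤ p + q
p≤p+q {p} {q} 0≤q = subst (_≤ p + q) (+-identityʳ p) (+-monoʳ-≤ p 0≤q)

q≤p+q : ∀ {p q} → 0ℚ ≤ p → q ≤ p + q
q≤p+q {p} {q} 0≤p = subst (_≤ p + q) (+-identityˡ q) (+-monoˡ-≤ q 0≤p)

advance-2-2 : ∀ q → advance (advance q v2) v2 ≡ dead
advance-2-2 dead       = refl
advance-2-2 (fresh _)  = refl
advance-2-2 (paused _) = refl

module _ (x : Seq 3) (N : ℕ) where

  roots : List (Str 2)
  roots = applyUpTo (output x) (suc N)

  Covered : Family 2 → ℕ → ℕ → Set
  Covered c L m = ∀ ζ → length ζ ≡ L →
    1ℚ ≤ fromℕ (1 ℕ.∸ survivors x N L ζ) + hits roots (applyUpTo c m) ζ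

module _ (em : ExcludedMiddle 0ℓ) (x : Seq 3) (N : ℕ) (c : Family 2) (covers : ∀ {y z} → ⟪ x ⟫ y z → z ∈ ⋃ c) where

  -- The target may vary from node to node. This lets a single application of König's lemma bound
  -- all targets at once, and it does no harm on a path, where `alive` only serves to exclude 2
  -- after 2 and `avoids` speaks of the output alone.
  record Uncovered (v : ℕ) : Set where
    constructor uncovered
    field
      target : Str 2
      long   : v ℕ.≤ length target
      alive  : status x N target v ≢ dead
      avoids : ∀ k σ → c k ≡ just σ → ¬ σ ⊑ output x v

  status-parent : ∀ ζ v → status x N ζ (suc v) ≢ dead → status x N ζ (v ℕ./ 2) ≢ dead
  status-parent ζ v alive eq rewrite status-suc x N ζ v with suc v ℕ.∸ N in over
  ... | suc _ = alive (cong (λ q → advance q (x v)) eq)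
  ... | zero with () ← trans (sym eq) (status-reset x N ζ (v ℕ./ 2)
        (ℕ.≤-trans (m/n≤m v 2) (ℕ.<⇒≤ (ℕ.m∸n≡0⇒m≤n over))))

  uncovered-parent : ∀ v → Uncovered (suc v) → Uncovered (v ℕ./ 2)
  uncovered-parent v (uncovered ζ long alive avoids) =
    uncovered ζ (ℕ.≤-trans (m/n≤m v 2) (ℕ.<⇒≤ long)) (status-parent ζ v alive)
      λ k σ eq (ρ , σρ≡) → avoids k σ eq (ρ ++ mapMaybe bit? (x v ∷ []) ,
        trans (sym (++-assoc σ ρ _)) (trans (cong (_++ mapMaybe bit? (x v ∷ [])) σρ≡) (sym (output-suc x v))))

  status-↾ : ∀ ζ y n → N ℕ.≤ n →
    status x N ζ (index (y ↾ suc n)) ≡ advance (status x N ζ (index (y ↾ n))) (labels x y n)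
  status-↾ ζ y n N≤n = begin
    status x N ζ (index (y ↾ suc n))         ≡⟨ cong (status x N ζ) (index-↾-pred y n) ⟩
    status x N ζ (suc v)                     ≡⟨ status-suc x N ζ v ⟩
    statusStep x N ζ (status x N ζ (v ℕ./ 2)) (suc v)
      ≡⟨ cong (λ u → statusStep x N ζ (status x N ζ u) (suc v)) (pred-index-/ y n) ⟩
    statusStep x N ζ q (suc v)               ≡⟨ past (suc v ℕ.∸ N) (ℕ.m<n⇒0<n∸m N<1+v) ⟩
    advance q (labels x y n)                 ∎
    where
    open ≡-Reasoning
    v = pred (index (y ↾ suc n))
    q = status x N ζ (index (y ↾ n))
    N<1+v : N ℕ.< suc v
    N<1+v = ℕ.≤-trans (s≤s N≤n) (ℕ.≤-trans (n≤index-↾ y (suc n)) (ℕ.≤-reflexive (index-↾-pred y n)))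
    past : ∀ d → 0 ℕ.< d → ifz d (fresh ζ) (advance q (x v)) ≡ advance q (x v)
    past (suc _) _ = refl

  uncovered-recurrent : ∀ y → (∀ n → Uncovered (index (y ↾ n))) → Recurrent (labels x y)
  -- Beyond level N every node has a number above N, so no reset intervenes and two consecutive
  -- labels 2 would kill the node.
  uncovered-recurrent y unc m with labels x y (m ℕ.+ N) Fin.≟ v2 | labels x y (suc (m ℕ.+ N)) Fin.≟ v2
  ... | no ≢2  | _      = m ℕ.+ N , ℕ.m≤m+n m N , ≢2
  ... | yes _  | no ≢2  = suc (m ℕ.+ N) , ℕ.m≤n⇒m≤1+n (ℕ.m≤m+n m N) , ≢2
  ... | yes ≡2 | yes ≡2′ with uncovered ζ _ alive _ ← unc (suc (suc (m ℕ.+ N))) = ⊥-elim (alive (begin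
      status x N ζ (index (y ↾ suc (suc j)))
        ≡⟨ status-↾ ζ y (suc j) (ℕ.m≤n⇒m≤1+n (ℕ.m≤n+m N m)) ⟩
      advance (status x N ζ (index (y ↾ suc j))) (labels x y (suc j))
        ≡⟨ cong₂ advance (status-↾ ζ y j (ℕ.m≤n+m N m)) ≡2′ ⟩
      advance (advance (status x N ζ (index (y ↾ j))) (labels x y j)) v2
        ≡⟨ cong (λ a → advance (advance (status x N ζ (index (y ↾ j))) a) v2) ≡2 ⟩
      advance (advance (status x N ζ (index (y ↾ j))) v2) v2
        ≡⟨ advance-2-2 (status x N ζ (index (y ↾ j))) ⟩
      dead ∎))
    where
    open ≡-Reasoning
    j = m ℕ.+ N

  -- The output of such a path is a point of the range, so it lies in a cylinder of the cover; at a
  -- finite node the output is exactly the string of that cylinder.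
  no-uncovered-path : ∀ (y : Seq 2) → ¬ (∀ n → Uncovered (index (y ↾ n)))
  no-uncovered-path y unc
    with k , σ , eq , z∈σ ← covers {y} (deletes-2s (labels x y) (uncovered-recurrent y unc))
    with m , eq′ ← deletes-2s (labels x y) (uncovered-recurrent y unc) (length σ) =
    Uncovered.avoids (unc m) k σ eq
      ([] , trans (++-identityʳ σ) (sym (trans (output-↾ x y m) (trans eq′ z∈σ))))

  open König em Uncovered (λ y n t → subst Uncovered (pred-index-/ y n)
    (uncovered-parent _ (subst Uncovered (index-↾-pred y n) t)))

  Covering : ℕ → ℕ → ℕ → Set
  Covering B v k = ∀ ζ → B ℕ.≤ v → v ℕ.≤ length ζ → status x N ζ v ≢ dead →
    ∃ λ σ → c k ≡ just σ × σ ⊑ output x v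

  covering : ∀ B → (∀ v → B ℕ.≤ v → ¬ Uncovered v) → ∀ v → ∃ (Covering B v)
  covering B none v with em {∃ λ k → ∃ λ σ → c k ≡ just σ × σ ⊑ output x v}
  ... | yes (k , p) = k , λ _ _ _ _ → p
  -- The 0 is a dummy: if no cylinder covers the output at v and B ≤ v, then no sufficiently long
  -- target is alive there.
  ... | no  ¬p      = 0 , λ ζ B≤v long alive →
    ⊥-elim (none v B≤v (uncovered ζ long alive λ k σ eq pre → ¬p (k , σ , eq , pre)))

  module _ (B L m : ℕ) (B≤L/2 : B ℕ.≤ L ℕ./ 2)
    (bound : ∀ v → v ℕ.< suc L → ∃ λ k → k ℕ.< m × Covering B v k) where

    alive-hit : ∀ ζ → length ζ ≡ L → ∀ v → B ℕ.≤ v → v ℕ.≤ L → status x N ζ v ≢ dead →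
      1ℚ ≤ hits (roots x N) (applyUpTo c m) ζ
    alive-hit ζ refl v B≤v v≤L alive
      with k , k<m , cover ← bound v (s≤s v≤L)
      with σ , eq , τ , στ≡ ← cover ζ B≤v v≤L alive
      with ρ , eq′ ← alive-remaining (status x N ζ v) alive
      with factored {r} {o} r≤N out≡ ζ≡ _ ← status-factored x N ζ v v≤L ρ eq′ =
      1≤hits (output x) (suc N) c m ζ (s≤s r≤N) k<m eq (τ ++ ρ , (begin
        σ ++ (τ ++ ρ)          ≡⟨ ++-assoc σ τ ρ ⟨
        (σ ++ τ) ++ ρ          ≡⟨ cong (_++ ρ) (trans στ≡ out≡) ⟩
        (output x r ++ o) ++ ρ ≡⟨ ++-assoc (output x r) o ρ ⟩
        output x r ++ o ++ ρ   ≡⟨ cong (output x r ++_) ζ≡ ⟨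
        output x r ++ ζ        ∎))
      where open ≡-Reasoning

    hit-or-extinct : ∀ ζ → length ζ ≡ L →
      1ℚ ≤ fromℕ (1 ℕ.∸ survivors x N L ζ) + hits (roots x N) (applyUpTo c m) ζ
    hit-or-extinct ζ len≡ with survivors x N L ζ ℕ.≟ 0
    ... | yes none = ≤-trans (≤-reflexive (cong (λ n → fromℕ (1 ℕ.∸ n)) (sym none)))
      (p≤p+q (0≤hits (roots x N) (applyUpTo c m) ζ))
    ... | no some with j , j< , ≢0 ← ∑<≢0 (2 ℕ.+ L) (λ j → encode (frontier x N ζ L j)) some =
      ≤-trans
        (alive-hit ζ len≡ ((L ℕ.+ j) ℕ./ 2) (ℕ.≤-trans B≤L/2 (/-monoˡ-≤ 2 (ℕ.m≤m+n L j)))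
          (frontier-node-≤ L j j<) (λ eq → ≢0 (cong encode eq)))
        (q≤p+q (0≤fromℕ (1 ℕ.∸ survivors x N L ζ)))

  -- With L = 2B the parents on the frontier are numbered from B to L: large enough that a live one
  -- has covered output, and small enough for targets of length L. Finitely many nodes use finitely
  -- many cylinders, whence m.
  eventually-covered : ∃ λ L → ∃ (Covered x N c L)
  eventually-covered = fromBound (finite no-uncovered-path)
    where
    fromChoice : ∀ B → (∃ λ m → ∀ v → v ℕ.< suc (B ℕ.* 2) → ∃ λ k → k ℕ.< m × Covering B v k) →
      ∃ (Covered x N c (B ℕ.* 2))
    fromChoice B (m , bound) = m , hit-or-extinct B (B ℕ.* 2) m (ℕ.≤-reflexive (sym (m*n/n≡m B 2))) bound
    fromBound : (∃ λ B → ∀ v → B ℕ.≤ v → ¬ Uncovered v) → ∃ λ L → ∃ (Covered x N c L)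
    fromBound (B , none) = B ℕ.* 2 , fromChoice B (bounded-choice {Covering B} (suc (B ℕ.* 2)) (covering B none))

0<expansion : ∀ f n → 0ℚ < expansion (applyUpTo f (suc n))
0<expansion f n = <-≤-trans (positive⁻¹ 1ℚ) (≤-trans (1≤2^ (length (f 0)))
  (∑-term {g = λ w → 2ℚ ^ length w} (λ w → 0≤^ (length w) (nonNegative⁻¹ 2ℚ)) f (suc n) 0 z<s))

module _ (em : ExcludedMiddle 0ℓ) (x : Seq 3) (i : ℕ) (passes : ∀ L → check i (index (x ↾ L)) ≢ 0) where

  private
    N = threshold i
    ws = roots x N
    U = expansion ws

    instance
      U-positive : Positive U
      U-positive = positive (0<expansion (output x) N)

      U-nonZero : NonZero U
      U-nonZero = pos⇒nonZero U

    -- The frequency of hits is at most U times the total weight, and about half of the targets must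
    -- be hit. U sums 2^(length) over the outputs of the nodes up to N and does not involve the
    -- cover.
    r = ½ * 1/ U

    0<r : 0ℚ < r
    0<r = positive⁻¹ r {{pos*pos⇒pos ½ (1/ U) {{1/pos⇒pos U}}}}

    U*r≡½ : U * r ≡ ½
    U*r≡½ = begin
      U * (½ * 1/ U)   ≡⟨ solve 2 (λ u v → u :* (con ½ :* v) := con ½ :* (u :* v)) refl U (1/ U) ⟩
      ½ * (U * 1/ U)   ≡⟨ cong (½ *_) (*-inverseʳ U) ⟩
      ½                ∎
      where
      open ≡-Reasoning
      open +-*-Solver

  -- Averaging `Covered` gives 1 ≤ (fraction of extinct targets) + U S. If S < r, then U S < ½ and
  -- more than half of the targets of length L are extinct, so `check` vanishes at L, against
  -- `passes`.
  covered⇒r≤total : ∀ c L m → Covered x N c L m → r ≤ partialSum c m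
  covered⇒r≤total c L m pointwise = ≮⇒≥ λ S<r → passes L (trans (check-index x L i)
    (ℕ.m≤n⇒m∸n≡0 (½<avg⇒2^d≤2∑ L (λ ζ → 1 ℕ.∸ survivors x N L ζ) (½<extinct S<r))))
    where
    S = partialSum c m
    extinct = avg L (λ ζ → fromℕ (1 ℕ.∸ survivors x N L ζ))
    1≤extinct+U*S : 1ℚ ≤ extinct + U * S
    1≤extinct+U*S = begin
      1ℚ                                             ≡⟨ avg-const L 1ℚ ⟨
      avg L (λ _ → 1ℚ)                               ≤⟨ avg-mono L pointwise ⟩
      avg L (λ ζ → fromℕ (1 ℕ.∸ survivors x N L ζ) + hits ws (applyUpTo c m) ζ)
        ≡⟨ avg-+ L (λ ζ → fromℕ (1 ℕ.∸ survivors x N L ζ)) (hits ws (applyUpTo c m)) ⟩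
      extinct + avg L (hits ws (applyUpTo c m))      ≤⟨ +-monoʳ-≤ extinct (hits-avg L ws (applyUpTo c m)) ⟩
      extinct + U * S                                ∎
      where open ≤-Reasoning
    ½<extinct : S < r → ½ < extinct
    ½<extinct S<r = ≰⇒> λ extinct≤½ → <-irrefl refl (≤-<-trans 1≤extinct+U*S
      (+-mono-≤-< extinct≤½ (subst (U * S <_) U*r≡½ (*-monoʳ-<-pos U S<r))))

  range-positive : Measure> (ran ⟪ x ⟫) 0ℚ
  range-positive = r , 0<r , λ c covers → conclude c (eventually-covered em x N c (λ {y} yz → covers (y , yz)))
    where
    conclude : ∀ c → (∃ λ L → ∃ (Covered x N c L)) → ∃ λ n → r ≤ partialSum c n
    conclude c (L , m , pointwise) = m , covered⇒r≤total c L m pointwise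

theorem6p3 : ExcludedMiddle 0ℓ →
    (F : PartialMap) → RandomContinuous F → Measure> (ran F) 0ℚ
theorem6p3 em F (x , random , F⇔⟪x⟫) = fromTest (random-passes em x random)
  where
  fromTest : (∃ λ i → ∀ L → check i (index (x ↾ L)) ≢ 0) → Measure> (ran F) 0ℚ
  fromTest (i , passes) = transport (range-positive em x i passes)
    where
    transport : Measure> (ran ⟪ x ⟫) 0ℚ → Measure> (ran F) 0ℚ
    transport (r , 0<r , large) =
      r , 0<r , λ c covers → large c λ { {z} (y , yz) → covers (y , Equivalence.from (F⇔⟪x⟫ y z) yz) }
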